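{- Let $G$ be a finite simple $4$-regular graph that contains no cycle of length $3$. Then $a'(G)\le 6$, i.e., $G$ admits an acyclic edge coloring using at most $6$ colors.
   Context: A proper edge-$k$-coloring of a graph $G$ is a map $c:E(G)\to\{1,\dots,k\}$ such that any two edges sharing an endpoint receive different colors. It is acyclic if there is no bichromatic cycle, i.e., for any two colors the union of the two color classes induces a forest. The acyclic chromatic index $a'(G)$ is the smallest $k$ such that $G$ has an acyclic proper edge-$k$-coloring. -}

module Defs where

open import Data.Nat using (ℕ; zero; suc; _+_)
open import Data.Bool using (Bool; true; false; if_then_else_)
open import Data.Fin using (Fin; zero; suc; inject₁; fromℕ)
open import Data.List using (List; map; allFin)
open import Data.Nat.ListAction using (sum)
open import Data.Product using (Σ; _×_; ∃)
open import Data.Sum using (_⊎_)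
open import Relation.Binary.PropositionalEquality using (_≡_; _≢_)
open import Relation.Nullary using (¬_)
open import Function.Definitions using (Injective)

record Graph (n : ℕ) : Set where
  field
    adj    : Fin n → Fin n → Bool
    sym    : ∀ u v → adj u v ≡ adj v u
    irrefl : ∀ v → adj v v ≡ false

open Graph public

Adj : ∀ {n} → Graph n → Fin n → Fin n → Set
Adj G u v = adj G u v ≡ true

degree : ∀ {n} → Graph n → Fin n → ℕ
degree {n} G v = sum (map (λ w → if adj G v w then 1 else 0) (allFin n))

Regular : ∀ {n} → ℕ → Graph n → Set
Regular r G = ∀ v → degree G v ≡ r

TriangleFree : ∀ {n} → Graph n → Set
TriangleFree G = ∀ u v w → ¬ (Adj G u v × Adj G v w × Adj G w u)

-- An edge-colouring with k colours: a symmetric assignment of a colour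
-- to each ordered pair of vertices; only its values on edges matter.
record EdgeColouring {n} (G : Graph n) (k : ℕ) : Set where
  field
    col    : Fin n → Fin n → Fin k
    colSym : ∀ u v → col u v ≡ col v u

open EdgeColouring public

Proper : ∀ {n k} {G : Graph n} → EdgeColouring G k → Set
Proper {G = G} c = ∀ u v w → Adj G u v → Adj G u w → v ≢ w → col c u v ≢ col c u w

-- A cycle of length m + 3 in G: distinct vertices f 0, …, f (m+2) with
-- consecutive vertices adjacent and f (m+2) adjacent to f 0.
record Cycle {n} (G : Graph n) (m : ℕ) : Set where
  field
    vert     : Fin (suc (suc (suc m))) → Fin n
    distinct : Injective _≡_ _≡_ vert
    step     : ∀ (i : Fin (suc (suc m))) → Adj G (vert (inject₁ i)) (vert (suc i))
    close    : Adj G (vert (fromℕ (suc (suc m)))) (vert zero)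

open Cycle public

IsBichromatic : ∀ {n k m} {G : Graph n} → EdgeColouring G k → Cycle G m → Fin k → Fin k → Set
IsBichromatic {m = m} c C a b =
  a ≢ b
  × (∀ (i : Fin (suc (suc m))) →
       let x = col c (vert C (inject₁ i)) (vert C (suc i)) in x ≡ a ⊎ x ≡ b)
  × (let x = col c (vert C (fromℕ (suc (suc m)))) (vert C zero) in x ≡ a ⊎ x ≡ b)

Acyclic : ∀ {n k} {G : Graph n} → EdgeColouring G k → Set
Acyclic {G = G} c = ∀ m (C : Cycle G m) a b → ¬ IsBichromatic c C a b

AcyclicEdgeColourable : ∀ {n} → Graph n → ℕ → Set
AcyclicEdgeColourable G k = Σ (EdgeColouring G k) λ c → Proper c × Acyclic c

{-# OPTIONS --safe #-}
module Submission where

-- The vertices are added one at a time. Suppose that all edges but those at v are coloured,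
-- and let F₀, …, F₃ be the sets of three colours at the neighbours u₀, …, u₃ of v. Giving the
-- edges vuᵢ distinct colours sᵢ ∉ Fᵢ fails only if, for some i ≠ j, a path with alternating
-- colours sᵢ and sⱼ joins uᵢ to uⱼ. In two given colours a neighbour is so linked to at most
-- one other, and each link reveals a colour at a neighbour of uᵢ. One may also colour only
-- three edges at v and uncolour those at the fourth neighbour uᵢ, which then becomes the
-- missing vertex and sees other sets. Up to names there are 40 families (F₀, …, F₃), and for
-- each a small game tree shows that these moves succeed, except in two situations:
-- * F₀ and Fⱼ are complementary and linked in all nine pairs of colours. Then the colours
--   around u₀ can be rotated, and one of the three rotations destroys the links.
-- * The four sets are equal. Then the missing vertex can be pushed along an alternating
--   path, which must end.

open import Data.Nat using (ℕ)
open import Defs hiding (sym)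

import Algebra.Properties.CommutativeMonoid.Sum as CommutativeMonoidSum
open import Data.Bool using (Bool; true; false; if_then_else_; _∧_; _∨_; not; T)
open import Data.Bool.ListAction using (any; all)
import Data.Bool.Properties as Bool
open import Data.Empty using (⊥; ⊥-elim)
open import Data.Fin using (Fin; zero; suc; toℕ; fromℕ; fromℕ<; inject₁; punchIn; punchOut)
open import Data.Fin.Patterns
open import Data.Fin.Permutation using
  (Permutation′; permutation; _⟨$⟩ʳ_; _⟨$⟩ˡ_; inverseˡ; inverseʳ; transpose; lift₀; _∘ₚ_)
import Data.Fin.Permutation as Perm
import Data.Fin.Permutation.Components as PC
open import Data.Fin.Properties using
  (_≟_; any?; punchIn-punchOut; punchInᵢ≢i; toℕ-injective; toℕ-fromℕ<; toℕ-inject₁; toℕ<n)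
open import Data.List using
  (List; []; _∷_; _++_; map; concatMap; filter; filterᵇ; allFin; length)
import Data.List as List
open import Data.List.Membership.Propositional using (_∈_; find)
open import Data.List.Membership.Propositional.Properties using
  (∈-filter⁺; ∈-filter⁻; ∈-allFin; ∈-lookup; ∈-map⁺; ∈-map⁻; ∈-++⁺ˡ; ∈-++⁺ʳ; ∈-++⁻)
open import Data.List.Relation.Unary.All using (All; []; _∷_)
import Data.List.Relation.Unary.All as All
open import Data.List.Relation.Unary.All.Properties using (all⁺; all⁻; ++⁺; ++⁻ˡ; ++⁻ʳ)
open import Data.List.Relation.Unary.AllPairs using (AllPairs; []; _∷_)
open import Data.List.Relation.Unary.Any using (here; there; index)
open import Data.List.Relation.Unary.Any.Properties using (any⁻; lookup-index)
open import Data.List.Relation.Unary.Unique.Propositional using (Unique)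
import Data.List.Relation.Unary.Unique.Propositional.Properties as Unique
open import Data.Maybe using (Maybe; just; nothing)
import Data.Maybe as Maybe
import Data.Maybe.Properties as Maybe
open import Data.Maybe.Properties using (just-injective)
open import Data.Nat using
  (zero; suc; _+_; _≡ᵇ_; _<ᵇ_; _≤ᵇ_; _≤_; _<_)
open import Data.Nat.DivMod using (_/_; _%_)
open import Data.Nat.ListAction using (sum)
import Data.Nat.Properties as ℕ
open import Data.Product using (∃; _×_; _,_; proj₁; proj₂)
open import Data.Sum using (_⊎_; inj₁; inj₂; [_,_]′)
open import Data.Vec using (Vec; []; _∷_; lookup; tabulate; insertAt)
import Data.Vec as Vec
import Data.Vec.Properties as Vec
open import Data.Vec.Properties using (lookup∘tabulate)
open import Function using (_∘_; case_of_; id)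
open import Relation.Binary.Definitions using (DecidableEquality)
open import Relation.Binary.PropositionalEquality using
  (_≡_; _≢_; refl; sym; trans; cong; subst; subst₂)
open import Relation.Nullary using (¬_; Dec; yes; no; contradiction)
open import Relation.Nullary.Decidable using (T?; toSum)

private module Sum = CommutativeMonoidSum ℕ.+-0-commutativeMonoid

-- A move trades one family for another, so the game needs a well-founded order. `level` supplies
-- it: each tree in the table wins provided that all families of smaller level are won. Four equal
-- sets alone have the top level 5. A move from them may lead back to four equal sets, so the length
-- of an alternating walk serves as the measure there. The set recorded at a neighbour is only an
-- upper bound for the colours present, because edges to vertices not yet added may be uncoloured.
-- Colours outside the set are still free, and a link proves that the colours it uses are really
-- present. When fewer than three colours occur, the set may be completed at will; choosing it so as
-- to miss a given colour is what ends the argument for four equal sets. Triangle-freeness keeps the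
-- recorded sets under control: colouring edges at a vertex does not disturb the colours at the
-- vertices whose sets are being recorded. It is used when the missing vertex moves and again when
-- colours are rotated.

≡true⇒T : ∀ {x} → x ≡ true → T x
≡true⇒T refl = _

T⇒≡true : ∀ {x} → T x → x ≡ true
T⇒≡true {true} _ = refl

∧-split : ∀ {x y} → T (x ∧ y) → T x × T y
∧-split {true} p = _ , p

∨-split : ∀ {x y} → T (x ∨ y) → T x ⊎ T y
∨-split {true}  p = inj₁ _
∨-split {false} p = inj₂ p

∧-intro : ∀ {x y} → T x → T y → T (x ∧ y)
∧-intro {true} _ p = p

if-split : ∀ {x y z} → T (if x then y else z) → (T x × T y) ⊎ T z
if-split {true}  p = inj₁ (_ , p)
if-split {false} p = inj₂ p

∨-introˡ : ∀ {x y} → T x → T (x ∨ y)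
∨-introˡ {true} _ = _

∨-introʳ : ∀ x {y} → T y → T (x ∨ y)
∨-introʳ true  _ = _
∨-introʳ false p = p

T-not : ∀ {x} → T (not x) → ¬ T x
T-not {true} ()

not-T : ∀ {x} → ¬ T x → T (not x)
not-T {true}  p = ⊥-elim (p _)
not-T {false} p = _

all-∈ : ∀ {A : Set} (p : A → Bool) xs {x} → T (all p xs) → x ∈ xs → T (p x)
all-∈ p xs t = All.lookup (all⁺ p xs t)

all-intro : ∀ {A : Set} (p : A → Bool) xs → (∀ x → T (p x)) → T (all p xs)
all-intro p []       t = _
all-intro p (x ∷ xs) t = ∧-intro (t x) (all-intro p xs t)

any-∈ : ∀ {A : Set} (p : A → Bool) xs → T (any p xs) → ∃ λ x → x ∈ xs × T (p x)
any-∈ p xs t = find (any⁻ p xs t)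

pair-∈ : ∀ {A : Set} {R : A → A → Set} {xs x y} → AllPairs R xs → x ∈ xs → y ∈ xs →
         x ≡ y ⊎ R x y ⊎ R y x
pair-∈ (_ ∷ _)   (here refl) (here refl) = inj₁ refl
pair-∈ (rs ∷ _)  (here refl) (there q)   = inj₂ (inj₁ (All.lookup rs q))
pair-∈ (rs ∷ _)  (there p)   (here refl) = inj₂ (inj₂ (All.lookup rs p))
pair-∈ (_ ∷ rss) (there p)   (there q)   = pair-∈ rss p q

lookup-injective : ∀ {A : Set} {xs : List A} → Unique xs →
                   ∀ {i j} → List.lookup xs i ≡ List.lookup xs j → i ≡ j
lookup-injective (_ ∷ _)  {zero}  {zero}  _ = refl
lookup-injective (x∉ ∷ _) {zero}  {suc j} e = contradiction e (All.lookup x∉ (∈-lookup j))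
lookup-injective (x∉ ∷ _) {suc i} {zero}  e = contradiction (sym e) (All.lookup x∉ (∈-lookup i))
lookup-injective (_ ∷ u)  {suc i} {suc j} e = cong suc (lookup-injective u e)

-- Alternating walks in partial colourings

C : Set
C = Fin 6

module Walks {n : ℕ} (G : Graph n) where

  V : Set
  V = Fin n

  Adj-sym : ∀ {x y} → Adj G x y → Adj G y x
  Adj-sym {x} {y} p = trans (Graph.sym G y x) p

  Adj-irrefl : ∀ {x} → ¬ Adj G x x
  Adj-irrefl {x} p with () ← trans (sym p) (irrefl G x)

  Partial : Set
  Partial = V → V → Maybe C

  infixr 5 _∷_

  -- Walk c k a b x a′ b′ y: from x, following edges coloured a, b, a, … one reaches
  -- y in k steps; the next edge to follow would be coloured a′, the one after it b′.
  data Walk (c : Partial) : ℕ → C → C → V → C → C → V → Set where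
    []  : ∀ {a b x} → Walk c 0 a b x a b x
    _∷_ : ∀ {k a b x y a′ b′ z} → c x y ≡ just a →
          Walk c k b a y a′ b′ z → Walk c (suc k) a b x a′ b′ z

  Stuck : Partial → C → V → Set
  Stuck c a x = ∀ y → c x y ≢ just a

  record Halts (c : Partial) (a b : C) (x : V) : Set where
    constructor halting
    field
      {len}    : ℕ
      {next}   : C
      {after}  : C
      {end}    : V
      walk     : Walk c len a b x next after end
      stuck    : Stuck c next end

  -- That alternating walks halt is a positive form of acyclicity.
  record Valid (c : Partial) : Set where
    field
      symm   : ∀ x y → c x y ≡ c y x
      edge   : ∀ {x y a} → c x y ≡ just a → Adj G x y
      proper : ∀ {x y z a} → c x y ≡ just a → c x z ≡ just a → y ≡ z
      halts  : ∀ {a b} → a ≢ b → ∀ x → Halts c a b x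

    symm′ : ∀ {x y a} → c x y ≡ just a → c y x ≡ just a
    symm′ {x} {y} e = trans (symm y x) e

  Isolated : Partial → V → Set
  Isolated c v = ∀ y → c v y ≡ nothing

  _▷_ : ∀ {c k a b x a′ b′ y z} → Walk c k a b x a′ b′ y → c y z ≡ just a′ →
        Walk c (suc k) a b x b′ a′ z
  []      ▷ e = e ∷ []
  (d ∷ w) ▷ e = d ∷ (w ▷ e)

  colours : ∀ {c k a b x a′ b′ y} → Walk c k a b x a′ b′ y →
            (a′ ≡ a × b′ ≡ b) ⊎ (a′ ≡ b × b′ ≡ a)
  colours [] = inj₁ (refl , refl)
  colours (_ ∷ w) with colours w
  ... | inj₁ (p , q) = inj₂ (p , q)
  ... | inj₂ (p , q) = inj₁ (p , q)

  prepend : ∀ {c k a b x a′ b′ y} → Walk c k a b x a′ b′ y → Halts c a′ b′ y → Halts c a b x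
  prepend []      h = h
  prepend (e ∷ w) h with prepend w h
  ... | halting w′ s = halting (e ∷ w′) s

  departs : ∀ {c k a b x a′ b′ y} → Walk c k a b x a′ b′ y → x ≢ y → ∃ λ z → c x z ≡ just a
  departs []      x≢x = contradiction refl x≢x
  departs (e ∷ _) _   = _ , e

  departs² : ∀ {c k a b x y} → Walk c k a b x a b y → a ≢ b → x ≢ y →
             ∃ λ w → ∃ λ z → c x w ≡ just a × c w z ≡ just b
  departs² []           _   x≢x = contradiction refl x≢x
  departs² (_ ∷ [])     a≢a _   = contradiction refl a≢a
  departs² (e ∷ e′ ∷ _) _   _   = _ , _ , e , e′

  module _ {c : Partial} (ok : Valid c) where
    open Valid ok

    reverse : ∀ {k a b x a′ b′ y} → Walk c k a b x a′ b′ y → Walk c k b′ a′ y b a x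
    reverse []      = []
    reverse (e ∷ w) = reverse w ▷ symm′ e

    -- Compare the walk with its own reversal, edge by edge from both ends.
    no-return : ∀ {k a b x} → a ≢ b → ¬ Walk c k a b x b a x
    no-return {0} a≢b [] = a≢b refl
    no-return {1} a≢b (e ∷ []) = Adj-irrefl (edge e)
    no-return {suc (suc k)} a≢b (e ∷ w) with reverse w
    ... | e′ ∷ w′ with refl ← proper e e′ = no-return (a≢b ∘ sym) w′

    deterministic : ∀ {k k′ a b x p q y p′ q′ y′} →
      Walk c k a b x p q y → Stuck c p y → Walk c k′ a b x p′ q′ y′ → Stuck c p′ y′ →
      p ≡ p′ × y ≡ y′
    deterministic []      s []      s′ = refl , refl
    deterministic []      s (e ∷ _) s′ = contradiction e (s _)
    deterministic (e ∷ _) s []      s′ = contradiction e (s′ _)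
    deterministic (e ∷ w) s (e′ ∷ w′) s′ with refl ← proper e e′ = deterministic w s w′ s′

    -- Because `a` is free at `y`, a walk arriving there with `a` next is maximal. It must then be
    -- the unique halting walk from `x`, so it suffices to inspect where that one ends.
    walk? : ∀ {a b x y} → a ≢ b → Stuck c a y → Dec (∃ λ k → Walk c k a b x a b y)
    walk? {a} {b} {x} {y} a≢b s with halts a≢b x
    ... | halting {next = p} {after = q} {end = z} w t with p ≟ a | z ≟ y | colours w
    ... | no p≢a | _ | _ = no λ (_ , w′) → p≢a (proj₁ (deterministic w t w′ s))
    ... | yes _ | no z≢y | _ = no λ (_ , w′) → z≢y (proj₂ (deterministic w t w′ s))
    ... | yes refl | yes refl | inj₁ (_ , refl) = yes (_ , w)
    ... | yes refl | yes refl | inj₂ (refl , _) = ⊥-elim (a≢b refl)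

    avoids : ∀ {v k a b x a′ b′ y} → Isolated c v → x ≢ v → Walk c k a b x a′ b′ y → y ≢ v
    avoids iso x≢v []      = x≢v
    avoids iso x≢v (e ∷ w) = avoids iso
      (λ { refl → contradiction (trans (sym (symm′ e)) (iso _)) λ () }) w

  -- Up to the first visit of `y` both walks stay where the colourings agree, so they use the same
  -- edges and enter `y` together. The entering edge would then have the same colour in `c` and
  -- `c′`, against the last hypothesis. This is what tells the three rotations apart.
  no-meeting : ∀ {c c′ y} → Valid c → Valid c′ →
    (∀ {x z} → x ≢ y → z ≢ y → c′ x z ≡ c x z) → (∀ {x a} → c y x ≡ just a → c′ y x ≢ just a) →
    ∀ {k k′ p q x a b} → x ≢ y → Walk c k p q x a b y → ¬ Walk c′ k′ p q x a b y
  no-meeting ok ok′ off on x≢y [] w′ = x≢y refl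
  no-meeting ok ok′ off on x≢y (e ∷ w) [] = x≢y refl
  no-meeting {y = y} ok ok′ off on x≢y (_∷_ {y = z} e w) (_∷_ {y = z′} e′ w′) with z ≟ y | z′ ≟ y
  ... | yes refl | yes refl = on (Valid.symm′ ok e) (Valid.symm′ ok′ e′)
  ... | yes refl | no z′≢y = z′≢y (Valid.proper ok (trans (sym (off x≢y z′≢y)) e′) e)
  ... | no z≢y | _ with refl ← Valid.proper ok′ (trans (off x≢y z≢y) e) e′ =
    no-meeting ok ok′ off on z≢y w w′

  sub-halts : ∀ {c d} → Valid c → (∀ {x y a} → d x y ≡ just a → c x y ≡ just a) →
              ∀ {k a b x a′ b′ y} → Walk c k a b x a′ b′ y → Stuck c a′ y → Halts d a b x
  sub-halts ok sub [] s = halting [] (λ y e → s y (sub e))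
  sub-halts {d = d} ok sub (_∷_ {x = x} {y = y} e w) s with d x y in eq
  ... | nothing = halting [] λ z e′ →
          contradiction (trans (sym eq) (subst (λ u → d x u ≡ _) (Valid.proper ok (sub e′) e) e′)) λ ()
  ... | just a′ with refl ← just-injective (trans (sym (sub eq)) e) with sub-halts ok sub w s
  ... | halting w′ s′ = halting (eq ∷ w′) s′

  erase : Partial → V → Partial
  erase c v x y with x ≟ v | y ≟ v
  ... | yes _ | _     = nothing
  ... | no _  | yes _ = nothing
  ... | no _  | no _  = c x y

  erase⊆ : ∀ c v {x y a} → erase c v x y ≡ just a → c x y ≡ just a
  erase⊆ c v {x} {y} e with x ≟ v | y ≟ v
  erase⊆ c v () | yes _ | _
  erase⊆ c v () | no _  | yes _
  erase⊆ c v e  | no _  | no _ = e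

  erase-≢ : ∀ c {v x y} → x ≢ v → y ≢ v → erase c v x y ≡ c x y
  erase-≢ c {v} {x} {y} p q with x ≟ v | y ≟ v
  ... | yes x≡v | _ = contradiction x≡v p
  ... | no _ | yes y≡v = contradiction y≡v q
  ... | no _ | no _ = refl

  erase-isolated : ∀ c v → Isolated (erase c v) v
  erase-isolated c v y with v ≟ v
  ... | yes _ = refl
  ... | no v≢v = contradiction refl v≢v

  erase-keeps : ∀ {c u v} → Isolated c v → Isolated (erase c u) v
  erase-keeps {c} {u} {v} iso y with erase c u v y in eq
  ... | nothing = refl
  ... | just _ = contradiction (trans (sym (erase⊆ c u {v} {y} eq)) (iso y)) λ ()

  erase-valid : ∀ {c} v → Valid c → Valid (erase c v)
  erase-valid {c} v ok = record
    { symm = s ; edge = edge ∘ erase⊆ c v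
    ; proper = λ {x} {y} {z} e e′ → proper (erase⊆ c v {x} {y} e) (erase⊆ c v {x} {z} e′)
    ; halts = λ a≢b x → let open Halts (halts a≢b x) in
        sub-halts ok (λ {x} {y} → erase⊆ c v {x} {y}) walk stuck }
    where
    open Valid ok
    s : ∀ x y → erase c v x y ≡ erase c v y x
    s x y with x ≟ v | y ≟ v
    ... | yes _ | yes _ = refl
    ... | yes _ | no _  = refl
    ... | no _  | yes _ = refl
    ... | no _  | no _  = symm x y

  extend : Partial → V → (V → Maybe C) → Partial
  extend c v s x y with x ≟ v | y ≟ v
  ... | yes _ | _     = s y
  ... | no _  | yes _ = s x
  ... | no _  | no _  = c x y

  extend-≢ : ∀ c s {v x y} → x ≢ v → y ≢ v → extend c v s x y ≡ c x y
  extend-≢ c s {v} {x} {y} p q with x ≟ v | y ≟ v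
  ... | yes x≡v | _ = contradiction x≡v p
  ... | no _ | yes y≡v = contradiction y≡v q
  ... | no _ | no _ = refl

  extend-ˡ : ∀ c v s y → extend c v s v y ≡ s y
  extend-ˡ c v s y with v ≟ v
  ... | yes _ = refl
  ... | no v≢v = contradiction refl v≢v

  extend-ʳ : ∀ c v s x → extend c v s x v ≡ s x
  extend-ʳ c v s x with x ≟ v | v ≟ v
  ... | yes refl | _ = refl
  ... | no _ | yes _ = refl
  ... | no _ | no v≢v = contradiction refl v≢v

  -- `rainbow` and `free` keep the extended colouring proper; `unlinked` forbids the bichromatic
  -- cycles, which could only arise through the centre `v`.
  record Star (c : Partial) (v : V) (s : V → Maybe C) : Set where
    field
      adjacent : ∀ {y a} → s y ≡ just a → Adj G v y
      rainbow : ∀ {y z a} → s y ≡ just a → s z ≡ just a → y ≡ z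
      free     : ∀ {y a} → s y ≡ just a → Stuck c a y
      unlinked : ∀ {p q a b} → s p ≡ just a → s q ≡ just b → p ≢ q →
                 ∀ {k} → ¬ Walk c k b a p b a q

  module _ {c v s} (ok : Valid c) (iso : Isolated c v) (star : Star c v s) where
    open Valid ok
    open Star star

    private
      c⁺ : Partial
      c⁺ = extend c v s

      iso′ : ∀ {x a} → c x v ≢ just a
      iso′ {x} e = contradiction (trans (sym (symm′ e)) (iso x)) λ ()

      lift : ∀ {x y a} → c x y ≡ just a → c⁺ x y ≡ just a
      lift {x} {y} e = trans (extend-≢ c s
        (λ { refl → contradiction (trans (sym e) (iso y)) λ () })
        (λ { refl → iso′ e })) e

      lift-walk : ∀ {k a b x a′ b′ y} → Walk c k a b x a′ b′ y → Walk c⁺ k a b x a′ b′ y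
      lift-walk []      = []
      lift-walk (e ∷ w) = lift e ∷ lift-walk w

      s-v : ∀ {a} → s v ≢ just a
      s-v e = Adj-irrefl (adjacent e)

      off : ∀ {p a} → s p ≡ just a → p ≢ v
      off e refl = s-v e

      stuck⁺ : ∀ {a z} → z ≢ v → Stuck c a z → s z ≢ just a → Stuck c⁺ a z
      stuck⁺ {a} {z} z≢v st ne y e = case y ≟ v of λ where
        (yes y≡v) → ne (trans (sym (extend-ʳ c v s z)) (subst (λ u → c⁺ z u ≡ just a) y≡v e))
        (no y≢v)  → st y (trans (sym (extend-≢ c s z≢v y≢v)) e)

      -- A walk that has just left `v` through `p` never comes back: returning through `q` would be
      -- a link, and returning through `p` would reverse the walk into itself, which `no-return`
      -- excludes.
      halts-port : ∀ {p q a b} → s p ≡ just a → s q ≡ just b → a ≢ b → Halts c⁺ b a p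
      halts-port {p} {q} {a} {b} sp sq a≢b with halts (a≢b ∘ sym) p
      ... | halting {next = a′} {end = z} w st with Maybe.≡-dec _≟_ (s z) (just a′)
      ... | no ne = halting (lift-walk w) (stuck⁺ (avoids ok iso (off sp) w) st ne)
      ... | yes sz with colours w
      ... | inj₁ (refl , refl) with refl ← rainbow sz sq =
        contradiction w (unlinked sp sq λ { refl → a≢b (just-injective (trans (sym sp) sq)) })
      ... | inj₂ (refl , refl) with refl ← rainbow sz sp =
        contradiction w (no-return ok (a≢b ∘ sym))

      halts-≢ : ∀ {a b} → a ≢ b → ∀ {x} → x ≢ v → Halts c⁺ a b x
      halts-≢ a≢b {x} x≢v with halts a≢b x
      ... | halting {next = a′} {after = b′} {end = z} w st with Maybe.≡-dec _≟_ (s z) (just a′)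
      ... | no ne = halting (lift-walk w) (stuck⁺ (avoids ok iso x≢v w) st ne)
      ... | yes sz with any? (λ q → Maybe.≡-dec _≟_ (s q) (just b′))
      ... | no ne = halting (lift-walk w ▷ trans (extend-ʳ c v s z) sz)
                      (λ y e → ne (y , trans (sym (extend-ˡ c v s y)) e))
      -- The walk crosses `v` from `z` to `q`. By `halts-port` this is its only crossing.
      ... | yes (q , sq) = prepend
              ((lift-walk w ▷ trans (extend-ʳ c v s z) sz) ▷ trans (extend-ˡ c v s q) sq)
              (halts-port sq sz (b′≢a′ (colours w)))
        where
        b′≢a′ : _ → b′ ≢ a′
        b′≢a′ (inj₁ (refl , refl)) = a≢b ∘ sym
        b′≢a′ (inj₂ (refl , refl)) = a≢b

    extend-valid : Valid c⁺
    extend-valid = record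
      { symm = sy ; edge = λ {x} {y} → ed {x} {y} ; proper = λ {x} → pr {x} ; halts = ha }
      where
      sy : ∀ x y → c⁺ x y ≡ c⁺ y x
      sy x y with x ≟ v | y ≟ v
      ... | yes refl | yes refl = refl
      ... | yes _ | no _  = refl
      ... | no _  | yes _ = refl
      ... | no _  | no _  = symm x y
      ed : ∀ {x y a} → c⁺ x y ≡ just a → Adj G x y
      ed {x} {y} e with x ≟ v | y ≟ v
      ... | yes refl | _     = adjacent e
      ... | no _  | yes refl = Adj-sym (adjacent e)
      ... | no _  | no _  = edge e
      pr : ∀ {x y z a} → c⁺ x y ≡ just a → c⁺ x z ≡ just a → y ≡ z
      pr {x} {y} {z} e e′ with x ≟ v | y ≟ v | z ≟ v
      ... | yes _ | _ | _ = rainbow e e′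
      ... | no _ | yes refl | yes refl = refl
      ... | no _ | yes _ | no _ = contradiction e′ (free e _)
      ... | no _ | no _ | yes _ = contradiction e (free e′ _)
      ... | no _ | no _ | no _ = proper e e′
      ha : ∀ {a b} → a ≢ b → ∀ x → Halts c⁺ a b x
      ha {a} {b} a≢b x with x ≟ v
      ... | no x≢v = halts-≢ a≢b x≢v
      ... | yes refl with any? (λ q → Maybe.≡-dec _≟_ (s q) (just a))
      ... | no ne = halting [] (λ y e → ne (y , trans (sym (extend-ˡ c v s y)) e))
      ... | yes (q , sq) = prepend (trans (extend-ˡ c v s q) sq ∷ [])
                             (halts-≢ (a≢b ∘ sym) (off sq))

-- Families of four sets of colours

Subset : Set
Subset = Vec Bool 6

-- The family is stored by colour: bit i of P a tells whether a belongs to the i-th set.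
Config : Set
Config = C → Vec Bool 4

mem : Config → Fin 4 → C → Bool
mem P i a = lookup (P a) i

config : Subset → Subset → Subset → Subset → Config
config R S T U a = lookup R a ∷ lookup S a ∷ lookup T a ∷ lookup U a ∷ []

subsets : ℕ → ∀ n → List (Vec Bool n)
subsets zero    zero    = [] ∷ []
subsets (suc k) zero    = []
subsets zero    (suc n) = map (false ∷_) (subsets zero n)
subsets (suc k) (suc n) = map (true ∷_) (subsets k n) ++ map (false ∷_) (subsets (suc k) n)

triples : List Subset
triples = subsets 3 6

count : (Vec Bool 4 → ℕ) → Config → ℕ
count f P = Sum.sum (λ a → f (P a))

-- Hexadecimal digits, from the right: is the colour in none of the four sets, in exactly
-- one, in all; do the sets 01, 02, 03, 12, 13, 23 agree on it.
weight : Vec Bool 4 → ℕ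
weight (true  ∷ true  ∷ true  ∷ true  ∷ []) = 0x111111100
weight (true  ∷ true  ∷ true  ∷ false ∷ []) = 0x001011000
weight (true  ∷ true  ∷ false ∷ true  ∷ []) = 0x010101000
weight (true  ∷ true  ∷ false ∷ false ∷ []) = 0x100001000
weight (true  ∷ false ∷ true  ∷ true  ∷ []) = 0x100110000
weight (true  ∷ false ∷ true  ∷ false ∷ []) = 0x010010000
weight (true  ∷ false ∷ false ∷ true  ∷ []) = 0x001100000
weight (true  ∷ false ∷ false ∷ false ∷ []) = 0x111000010
weight (false ∷ true  ∷ true  ∷ true  ∷ []) = 0x111000000
weight (false ∷ true  ∷ true  ∷ false ∷ []) = 0x001100000
weight (false ∷ true  ∷ false ∷ true  ∷ []) = 0x010010000
weight (false ∷ true  ∷ false ∷ false ∷ []) = 0x100110010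
weight (false ∷ false ∷ true  ∷ true  ∷ []) = 0x100001000
weight (false ∷ false ∷ true  ∷ false ∷ []) = 0x010101010
weight (false ∷ false ∷ false ∷ true  ∷ []) = 0x001011010
weight (false ∷ false ∷ false ∷ false ∷ []) = 0x111111001

-- Two 3-subsets of six colours are complementary exactly when they agree on no colour, so zero
-- digits among the pair counts mark the complementary pairs.
zeros : ℕ → ℕ → ℕ
zeros zero    w = 0
zeros (suc k) w = (if w % 16 ≡ᵇ 0 then 1 else 0) + zeros k (w / 16)

-- The arguments count the colours in none, in exactly one, in all of the four sets, and
-- the complementary pairs among the sets. The moves of the table below lead to families of
-- smaller rank.
rank : ℕ → ℕ → ℕ → ℕ → ℕ
rank _ (suc _) _ 0       = 0
rank _ (suc _) _ 3       = 3
rank _ (suc _) _ _       = 1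
rank 0 0       _ 0       = 1
rank 0 0       _ (suc _) = 4
rank 1 0       0 _       = 2
rank 1 0       _ _       = 3
rank 2 0       0 _       = 2
rank 2 0       _ _       = 1
rank _ 0       _ _       = 5

grade : ℕ → ℕ
grade w = rank (w % 16) (w / 16 % 16) (w / 256 % 16) (zeros 6 (w / 4096))

-- Only six weights are added, so every hexadecimal digit stays at most 6 and no carry mixes the
-- counts.
level : Config → ℕ
level P = grade (count weight P)

-- fact i j a b: a walk along colours b, a, b, … leads from neighbour i to neighbour j, so
-- that the edges to these cannot be coloured a and b.
record Fact : Set where
  constructor fact
  field
    port₁ port₂     : Fin 4
    colour₁ colour₂ : C

flip : Fact → Fact
flip (fact i j a b) = fact j i b a

_==_ : ∀ {n} → Fin n → Fin n → Bool
zero  == zero  = true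
suc i == suc j = i == j
_     == _     = false

==⇒≡ : ∀ {n} {i j : Fin n} → T (i == j) → i ≡ j
==⇒≡ {i = zero}  {zero}  _ = refl
==⇒≡ {i = suc i} {suc j} p = cong suc (==⇒≡ p)

==-refl : ∀ {n} (i : Fin n) → T (i == i)
==-refl zero    = _
==-refl (suc i) = ==-refl i

≠⇒≢ : ∀ {n} {i j : Fin n} → T (not (i == j)) → i ≢ j
≠⇒≢ {i = i} p refl = T-not p (==-refl i)

same : Fact → Fact → Bool
same (fact i j a b) (fact i′ j′ a′ b′) = (i == i′) ∧ (j == j′) ∧ (a == a′) ∧ (b == b′)

-- An alternating walk is determined by its start and its colours, so two links that begin alike
-- cannot end at different neighbours.
splits : Fact → Fact → Bool
splits (fact i j a b) (fact i′ j′ a′ b′) = (i == i′) ∧ (a == a′) ∧ (b == b′) ∧ not (j == j′)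

clash : Fact → Fact → Bool
clash f g = splits f g ∨ splits f (flip g) ∨ splits (flip f) g ∨ splits (flip f) (flip g)

refuted : List Fact → List Fact → Fact → Bool
refuted ys ns f = any (same f) ns ∨ any (clash f) ys

-- Game trees and their verification

Spokes : Set
Spokes = List (Fin 4 × C)

-- full colours the four edges at the missing vertex; move i proposes several colourings of
-- the three edges other than that to neighbour i, which becomes the missing vertex. There is
-- a subtree for each fact that would forbid one of the proposed colourings. locked true
-- (false) says that neighbours 0 and 2 (3) are linked in all pairs of colours.
data Tree : Set where
  full   : (a b c d : C) → List Tree → Tree
  move   : Fin 4 → List (Vec C 3) → List Tree → Tree
  locked : Bool → Tree

pattern tri a b c = a ∷ b ∷ c ∷ []

wheel : C → C → C → C → Spokes
wheel a b c d = (0F , a) ∷ (1F , b) ∷ (2F , c) ∷ (3F , d) ∷ []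

rim : Fin 4 → Vec C 3 → Spokes
rim i (a ∷ b ∷ c ∷ []) = (punchIn i 0F , a) ∷ (punchIn i 1F , b) ∷ (punchIn i 2F , c) ∷ []

separate : Fin 4 × C → Fin 4 × C → Bool
separate (i , a) (j , b) = not (i == j) ∧ not (a == b)

suitable : Config → Spokes → Bool
suitable P []             = true
suitable P ((i , a) ∷ st) = not (mem P i a) ∧ all (separate (i , a)) st ∧ suitable P st

-- A link leaves neighbour `i` along `b` and enters neighbour `j` along `a`. It can be ignored
-- unless both colours may occur there.
conflict : Config → Fin 4 × C → Fin 4 × C → List Fact
conflict P (i , a) (j , b) = if mem P i b ∧ mem P j a then fact i j a b ∷ [] else []

conflictsWith : Config → Fin 4 × C → Spokes → List Fact
conflictsWith P p []       = []
conflictsWith P p (q ∷ st) = conflict P p q ++ conflictsWith P p st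

conflicts : Config → Spokes → List Fact
conflicts P []       = []
conflicts P (p ∷ st) = conflictsWith P p st ++ conflicts P st

rimConflicts : Config → Fin 4 → List (Vec C 3) → List Fact
rimConflicts P i []         = []
rimConflicts P i (st ∷ sts) = conflicts P (rim i st) ++ rimConflicts P i sts

-- The walk of fact j _ a b leaves neighbour j along b and continues along a.
need : Fin 4 → C → Fact → List C
need i x (fact j _ a b) = if (i == j) ∧ (x == b) then a ∷ [] else []

needs : List Fact → Fin 4 → C → List C
needs []       i x = []
needs (f ∷ ys) i x = need i x f ++ need i x (flip f) ++ needs ys i x

colourSet : ∀ {n} → Vec C n → Subset
colourSet cs = tabulate λ a → Vec.foldr _ (λ b r → (a == b) ∨ r) false cs

size : Subset → ℕ
size S = Sum.sum (λ a → if lookup S a then 1 else 0)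

every : List Subset → List Subset → List Subset → (Subset → Subset → Subset → Bool) → Bool
every Rs Ss Us Q = all (λ R → all (λ S → all (Q R S) Us) Ss) Rs

every-∈ : ∀ Rs Ss Us Q → T (every Rs Ss Us Q) → ∀ {R S U} → R ∈ Rs → S ∈ Ss → U ∈ Us → T (Q R S U)
every-∈ Rs Ss Us Q t {R} {S} R∈ S∈ =
  all-∈ (Q R S) Us (all-∈ (λ S → all (Q R S) Us) Ss
    (all-∈ (λ R → all (λ S → all (Q R S) Us) Ss) Rs t R∈) S∈)

saturating : Config → List Fact → Fin 4 → C → C → Bool
saturating P ys j a b = mem P 0F a ∨ not (mem P 0F b) ∨ any (same (fact 0F j a b)) ys

-- Opaque, because the normal form of a filtered list of length k has 2 ^ k leaves when
-- the predicate is not closed.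
opaque
  admissible : List C → List Subset
  admissible xs = filterᵇ (λ S → all (lookup S) xs) triples

  members : Config → Fin 4 → List C
  members P i = filterᵇ (mem P i) (allFin 6)

  ∈-admissible : ∀ {S xs} → S ∈ triples → (∀ {x} → x ∈ xs → T (lookup S x)) → S ∈ admissible xs
  ∈-admissible {S} {xs} S∈ all∈ =
    ∈-filter⁺ (T? ∘ λ S → all (lookup S) xs) S∈ (all⁻ (lookup S) (All.tabulate all∈))

  members-unique : ∀ P i → Unique (members P i)
  members-unique P i = Unique.filter⁺ (T? ∘ mem P i) (Unique.allFin⁺ 6)

  -- After the move the missing vertex is neighbour `i`. Its neighbours are the old missing vertex,
  -- with the proposed set `Z`, and the far ends of its edges coloured `x`, `y`, `z`, whose sets
  -- `R`, `S`, `U` are known only through the links found so far. The choice of `Z` may depend on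
  -- all three.
  lowers : ℕ → List Subset → List Fact → Fin 4 → List C → Bool
  lowers bound Zs ys i (x ∷ y ∷ z ∷ []) =
    every (admissible (needs ys i x)) (admissible (needs ys i y)) (admissible (needs ys i z))
      (λ R S U → any (λ Z → level (config Z R S U) <ᵇ bound) Zs)
  lowers bound Zs ys i _ = false

  lowers-sound : ∀ {bound Zs ys i} xs → T (lowers bound Zs ys i xs) →
    ∃ λ x → ∃ λ y → ∃ λ z → xs ≡ x ∷ y ∷ z ∷ [] × ∀ {R S U} →
    R ∈ admissible (needs ys i x) → S ∈ admissible (needs ys i y) →
    U ∈ admissible (needs ys i z) → ∃ λ Z → Z ∈ Zs × T (level (config Z R S U) <ᵇ bound)
  lowers-sound {bound} {Zs} {ys} {i} (x ∷ y ∷ z ∷ []) t =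
    x , y , z , refl , λ {R} {S} {U} R∈ S∈ U∈ →
    any-∈ (λ Z → level (config Z R S U) <ᵇ bound) Zs
      (every-∈ (admissible (needs ys i x)) (admissible (needs ys i y))
        (admissible (needs ys i z)) (λ R S U → any (λ Z → level (config Z R S U) <ᵇ bound) Zs)
        t R∈ S∈ U∈)

  saturated : Config → List Fact → Fin 4 → Bool
  saturated P ys j = all (λ a → all (saturating P ys j a) (allFin 6)) (allFin 6)

  saturated-sound : ∀ {P ys j} → T (saturated P ys j) →
    ∀ a b → T (not (mem P 0F a)) → T (mem P 0F b) → T (any (same (fact 0F j a b)) ys)
  saturated-sound {P} {ys} {j} t a b ta tb
    with ∨-split {mem P 0F a} (all-∈ (saturating P ys j a) (allFin 6)
           (all-∈ (λ a → all (saturating P ys j a) (allFin 6)) (allFin 6) t (∈-allFin a)) (∈-allFin b))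
  ... | inj₁ p = contradiction p (T-not ta)
  ... | inj₂ p with ∨-split {not (mem P 0F b)} p
  ... | inj₁ q = contradiction tb (T-not q)
  ... | inj₂ q = q

partner : Bool → Fin 4
partner true  = 2F
partner false = 3F

proposable : Config → Fin 4 → Vec C 3 → Bool
proposable P i st = suitable P (rim i st) ∧ (size (colourSet st) ≡ᵇ 3)

-- The facts ys are known to hold, the facts ns to fail.
mutual
  check : ℕ → Config → List Fact → List Fact → Tree → Bool
  check bound P ys ns (full a b c d ts) =
    suitable P (wheel a b c d) ∧ branch bound P ys ns (conflicts P (wheel a b c d)) ts
  check bound P ys ns (move i sts ts) =
    all (proposable P i) sts ∧ lowers bound (map colourSet sts) ys i (members P i)
      ∧ branch bound P ys ns (rimConflicts P i sts) ts
  check bound P ys ns (locked s) = saturated P ys (partner s)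

  branch : ℕ → Config → List Fact → List Fact → List Fact → List Tree → Bool
  branch bound P ys ns []       ts = true
  branch bound P ys ns (f ∷ fs) [] = refuted ys ns f ∧ branch bound P ys ns fs []
  branch bound P ys ns (f ∷ fs) (t ∷ ts) =
    if refuted ys ns f then branch bound P ys ns fs (t ∷ ts)
    else (check bound P (f ∷ ys) ns t ∧ branch bound P ys (f ∷ ns) fs ts)

-- The table of families and their trees

record Entry : Set where
  constructor entry
  field
    row₀ row₁ row₂ row₃ : Subset
    tree : Tree

  form : Config
  form = config row₀ row₁ row₂ row₃

row : C → C → C → Subset
row a b c = colourSet (a ∷ b ∷ c ∷ [])

triple-sizes : all (λ S → size S ≡ᵇ 3) triples ≡ true
triple-sizes = refl

triple-size : ∀ {S} → S ∈ triples → size S ≡ 3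
triple-size {S} S∈ = ℕ.≡ᵇ⇒≡ (size S) 3 (all-∈ (λ S → size S ≡ᵇ 3) triples (≡true⇒T triple-sizes) S∈)

distinct₃ : ∀ {A : Set} {x y z : A} → Unique (x ∷ y ∷ z ∷ []) →
            ∀ k l → lookup (x ∷ y ∷ z ∷ []) k ≡ lookup (x ∷ y ∷ z ∷ []) l → k ≡ l
distinct₃ u 0F 0F _ = refl
distinct₃ u 1F 1F _ = refl
distinct₃ u 2F 2F _ = refl
distinct₃ ((x≢y ∷ _) ∷ _) 0F 1F e = contradiction e x≢y
distinct₃ ((_ ∷ x≢z ∷ _) ∷ _) 0F 2F e = contradiction e x≢z
distinct₃ (_ ∷ (y≢z ∷ _) ∷ _) 1F 2F e = contradiction e y≢z
distinct₃ ((x≢y ∷ _) ∷ _) 1F 0F e = contradiction (sym e) x≢y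
distinct₃ ((_ ∷ x≢z ∷ _) ∷ _) 2F 0F e = contradiction (sym e) x≢z
distinct₃ (_ ∷ (y≢z ∷ _) ∷ _) 2F 1F e = contradiction (sym e) y≢z

Threefold : Config → Set
Threefold P = ∀ i → count (λ v → if lookup v i then 1 else 0) P ≡ 3

-- Found by computer search. Up to the names of colours and neighbours these are all families
-- of 3-subsets, except four equal ones.
table : List Entry
table =
  entry (row 0F 1F 2F) (row 0F 1F 2F) (row 0F 1F 2F) (row 0F 1F 3F)
    (full 3F 4F 5F 2F ((full 4F 3F 5F 2F []) ∷ [])) ∷
  entry (row 0F 1F 2F) (row 0F 1F 2F) (row 0F 1F 2F) (row 0F 3F 4F)
    (full 3F 4F 5F 1F ((full 4F 3F 5F 1F ((full 5F 3F 4F 1F []) ∷ [])) ∷ (full 3F 5F 4F 1F []) ∷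
     [])) ∷
  entry (row 0F 1F 2F) (row 0F 1F 2F) (row 0F 1F 3F) (row 0F 1F 4F)
    (full 3F 5F 4F 2F []) ∷
  entry (row 0F 1F 2F) (row 0F 1F 2F) (row 0F 1F 3F) (row 0F 2F 4F)
    (full 3F 4F 2F 5F ((full 4F 3F 2F 5F []) ∷ [])) ∷
  entry (row 0F 1F 2F) (row 0F 1F 2F) (row 0F 1F 3F) (row 0F 3F 4F)
    (full 3F 4F 2F 5F ((full 3F 5F 4F 2F []) ∷ [])) ∷
  entry (row 0F 1F 2F) (row 0F 1F 2F) (row 0F 1F 3F) (row 2F 3F 4F)
    (full 3F 4F 2F 5F ((full 4F 3F 2F 5F []) ∷ [])) ∷
  entry (row 0F 1F 2F) (row 0F 1F 2F) (row 0F 1F 3F) (row 0F 4F 5F)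
    (full 4F 5F 2F 3F []) ∷
  entry (row 0F 1F 2F) (row 0F 1F 2F) (row 0F 3F 4F) (row 0F 3F 5F)
    (full 3F 4F 5F 1F ((full 3F 5F 1F 4F []) ∷ [])) ∷
  entry (row 0F 1F 2F) (row 0F 1F 2F) (row 0F 3F 4F) (row 1F 3F 5F)
    (full 3F 4F 5F 2F ((full 3F 5F 2F 4F []) ∷ [])) ∷
  entry (row 0F 1F 2F) (row 0F 1F 3F) (row 0F 2F 3F) (row 0F 1F 4F)
    (full 3F 4F 5F 2F []) ∷
  entry (row 0F 1F 2F) (row 0F 1F 3F) (row 0F 2F 3F) (row 1F 2F 4F)
    (full 3F 2F 4F 5F ((full 4F 2F 5F 3F []) ∷ [])) ∷
  entry (row 0F 1F 2F) (row 0F 1F 3F) (row 0F 2F 3F) (row 0F 4F 5F)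
    (full 3F 2F 4F 1F ((full 3F 4F 1F 2F ((full 3F 4F 5F 1F ((full 4F 2F 5F 1F []) ∷ [])) ∷ []))
     ∷ [])) ∷
  entry (row 0F 1F 2F) (row 0F 1F 3F) (row 0F 1F 4F) (row 0F 1F 5F)
    (full 3F 4F 5F 2F []) ∷
  entry (row 0F 1F 2F) (row 0F 1F 3F) (row 0F 1F 4F) (row 0F 2F 5F)
    (full 5F 2F 3F 4F []) ∷
  entry (row 0F 1F 2F) (row 0F 1F 3F) (row 0F 2F 4F) (row 1F 2F 5F)
    (full 3F 4F 5F 0F ((full 4F 5F 3F 0F []) ∷ [])) ∷
  entry (row 0F 1F 2F) (row 0F 1F 3F) (row 0F 2F 4F) (row 0F 3F 5F)
    (full 3F 5F 1F 4F []) ∷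
  entry (row 0F 1F 2F) (row 0F 1F 3F) (row 0F 2F 4F) (row 2F 3F 5F)
    (full 3F 5F 1F 4F []) ∷
  entry (row 0F 1F 2F) (row 0F 1F 3F) (row 2F 3F 4F) (row 2F 3F 5F)
    (full 3F 4F 5F 0F ((full 3F 5F 0F 4F []) ∷ [])) ∷
  entry (row 0F 1F 2F) (row 0F 1F 3F) (row 2F 3F 4F) (row 0F 4F 5F)
    (full 3F 2F 5F 1F ((full 3F 4F 5F 1F ((full 4F 2F 5F 1F []) ∷ [])) ∷ [])) ∷
  entry (row 0F 1F 2F) (row 0F 1F 2F) (row 0F 1F 3F) (row 0F 1F 3F)
    (full 3F 4F 2F 5F ((full 3F 4F 5F 2F []) ∷ [])) ∷
  entry (row 0F 1F 2F) (row 0F 1F 2F) (row 0F 1F 3F) (row 0F 2F 3F)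
    (full 3F 4F 2F 5F ((full 4F 3F 2F 5F []) ∷ [])) ∷
  entry (row 0F 1F 2F) (row 0F 1F 2F) (row 0F 1F 3F) (row 2F 4F 5F)
    (full 4F 5F 2F 3F ((full 3F 4F 2F 0F ((full 3F 5F 4F 0F ((full 4F 3F 5F 0F []) ∷ [])) ∷
     (full 3F 4F 5F 0F ((full 3F 5F 4F 0F ((full 3F 4F 2F 1F ((full 3F 5F 4F 1F
     ((full 4F 3F 5F 1F []) ∷ [])) ∷ (move 2F (tri 3F 4F 1F ∷ tri 3F 5F 0F ∷ tri 4F 5F 0F ∷
     []) []) ∷ [])) ∷ [])) ∷ [])) ∷ [])) ∷ [])) ∷
  entry (row 0F 1F 2F) (row 0F 1F 2F) (row 0F 1F 3F) (row 3F 4F 5F)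
    (full 3F 4F 5F 2F ((full 4F 3F 5F 2F ((full 5F 3F 4F 2F ((full 3F 4F 2F 0F ((move 3F
     (tri 3F 4F 2F ∷ tri 3F 5F 2F ∷ []) []) ∷ (move 3F (tri 3F 4F 2F ∷ tri 3F 5F 2F ∷ []) []) ∷
     [])) ∷ [])) ∷ [])) ∷ (full 3F 5F 4F 2F ((full 4F 3F 5F 2F ((full 4F 3F 2F 0F ((move 3F
     (tri 4F 3F 2F ∷ tri 5F 3F 2F ∷ []) []) ∷ (move 3F (tri 4F 3F 2F ∷ tri 5F 3F 2F ∷ []) []) ∷
     [])) ∷ [])) ∷ [])) ∷ [])) ∷
  entry (row 0F 1F 2F) (row 0F 1F 2F) (row 0F 3F 4F) (row 3F 4F 5F)
    (full 3F 4F 5F 1F ((full 4F 3F 5F 1F ((full 3F 4F 5F 2F ((full 4F 3F 5F 2F ((full 3F 5F 1F 0F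
     ((move 0F (tri 3F 5F 1F ∷ tri 3F 5F 2F ∷ []) []) ∷ (full 3F 4F 5F 0F ((full 4F 3F 5F 0F
     ((move 3F (tri 3F 5F 2F ∷ tri 4F 5F 1F ∷ []) []) ∷ [])) ∷ [])) ∷ [])) ∷ [])) ∷
     (full 3F 5F 1F 2F ((full 4F 3F 5F 2F ((move 3F (tri 5F 3F 2F ∷ tri 5F 4F 2F ∷ []) []) ∷ []))
     ∷ [])) ∷ [])) ∷ [])) ∷ (full 4F 3F 5F 1F ((full 3F 4F 5F 2F ((full 3F 5F 2F 1F ((move 3F
     (tri 5F 3F 1F ∷ tri 5F 4F 1F ∷ []) []) ∷ [])) ∷ (full 4F 3F 5F 2F ((full 3F 5F 1F 2F
     ((full 3F 5F 2F 1F ((full 4F 5F 1F 2F ((full 4F 5F 2F 1F ((full 5F 3F 1F 0F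
     ((full 3F 4F 5F 0F ((move 0F (tri 3F 1F 0F ∷ tri 3F 2F 0F ∷ []) []) ∷ (move 1F (tri 4F 5F 0F
     ∷ tri 4F 5F 1F ∷ []) []) ∷ [])) ∷ (move 1F (tri 3F 5F 1F ∷ tri 3F 5F 2F ∷ []) []) ∷ [])) ∷
     (move 3F (tri 5F 3F 1F ∷ tri 5F 4F 1F ∷ []) []) ∷ [])) ∷ (move 3F (tri 5F 3F 2F ∷
     tri 5F 4F 2F ∷ []) []) ∷ [])) ∷ (move 3F (tri 5F 3F 1F ∷ tri 5F 4F 1F ∷ []) []) ∷ [])) ∷
     (move 3F (tri 5F 3F 2F ∷ tri 5F 4F 2F ∷ []) []) ∷ [])) ∷ [])) ∷ [])) ∷ [])) ∷ [])) ∷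
  entry (row 0F 1F 2F) (row 0F 1F 3F) (row 0F 2F 3F) (row 1F 4F 5F)
    (full 3F 4F 5F 2F ((full 3F 5F 4F 2F ((full 4F 2F 5F 3F ((full 4F 5F 1F 2F ((move 3F
     (tri 4F 2F 1F ∷ tri 4F 2F 5F ∷ []) []) ∷ [])) ∷ [])) ∷ [])) ∷ [])) ∷
  entry (row 0F 1F 2F) (row 0F 1F 3F) (row 0F 1F 4F) (row 2F 3F 5F)
    (full 3F 5F 2F 4F ((full 5F 2F 3F 4F ((full 3F 2F 5F 4F ((full 3F 4F 2F 0F ((full 4F 2F 3F 0F
     ((full 4F 5F 2F 0F ((full 5F 4F 2F 0F []) ∷ [])) ∷ [])) ∷ (full 3F 4F 5F 0F
     ((full 4F 2F 3F 0F ((move 3F (tri 3F 4F 2F ∷ tri 3F 4F 5F ∷ tri 4F 2F 5F ∷ []) []) ∷ [])) ∷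
     [])) ∷ [])) ∷ (full 3F 4F 2F 0F ((move 3F (tri 3F 4F 2F ∷ tri 3F 4F 5F ∷ []) []) ∷ (move 3F
     (tri 3F 4F 2F ∷ tri 3F 4F 5F ∷ []) []) ∷ [])) ∷ [])) ∷ [])) ∷ [])) ∷
  entry (row 0F 1F 2F) (row 0F 1F 3F) (row 0F 2F 4F) (row 1F 3F 5F)
    (full 3F 5F 1F 4F ((full 4F 2F 5F 0F ((full 4F 5F 1F 0F ((full 4F 5F 1F 2F ((move 2F
     (tri 3F 5F 4F ∷ tri 4F 5F 0F ∷ tri 4F 5F 2F ∷ tri 5F 2F 0F ∷ tri 4F 2F 0F ∷ []) []) ∷ [])) ∷
     [])) ∷ [])) ∷ [])) ∷
  entry (row 0F 1F 2F) (row 0F 1F 3F) (row 0F 2F 4F) (row 3F 4F 5F)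
    (full 3F 5F 1F 2F ((full 3F 2F 5F 1F ((full 4F 2F 5F 1F ((full 4F 5F 1F 2F ((full 3F 2F 1F 0F
     ((move 0F (tri 2F 3F 0F ∷ tri 5F 3F 2F ∷ []) ((move 0F (tri 4F 1F 2F ∷ tri 5F 3F 2F ∷
     tri 4F 5F 1F ∷ []) ((move 0F (tri 4F 3F 1F ∷ tri 5F 3F 2F ∷ []) ((move 0F (tri 5F 1F 0F ∷
     tri 5F 3F 2F ∷ tri 4F 5F 1F ∷ []) ((full 4F 2F 5F 0F ((move 0F (tri 4F 5F 0F ∷ tri 4F 5F 1F
     ∷ []) []) ∷ [])) ∷ [])) ∷ [])) ∷ [])) ∷ [])) ∷ (full 3F 2F 5F 0F ((full 3F 5F 1F 0F []) ∷
     [])) ∷ [])) ∷ [])) ∷ [])) ∷ [])) ∷ [])) ∷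
  entry (row 0F 1F 2F) (row 0F 1F 3F) (row 2F 3F 4F) (row 2F 4F 5F)
    (full 3F 4F 5F 0F ((full 3F 4F 5F 1F ((full 4F 2F 5F 0F ((full 4F 2F 5F 1F ((full 5F 2F 0F 3F
     ((move 1F (tri 4F 5F 0F ∷ tri 4F 5F 1F ∷ tri 3F 5F 0F ∷ tri 3F 5F 1F ∷ []) []) ∷ [])) ∷ []))
     ∷ [])) ∷ [])) ∷ [])) ∷
  entry (row 0F 1F 2F) (row 0F 3F 4F) (row 1F 3F 5F) (row 2F 4F 5F)
    (full 3F 1F 2F 0F ((full 3F 2F 0F 1F ((full 3F 5F 2F 0F ((full 3F 5F 0F 1F ((full 3F 5F 2F 1F
     ((full 4F 2F 0F 3F ((full 4F 5F 0F 1F ((full 3F 5F 4F 1F ((full 4F 1F 0F 3F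
     ((full 4F 1F 2F 0F ((move 0F (tri 2F 0F 3F ∷ tri 2F 4F 1F ∷ []) []) ∷ [])) ∷ [])) ∷ [])) ∷
     [])) ∷ [])) ∷ [])) ∷ [])) ∷ [])) ∷ (full 3F 2F 4F 0F ((full 3F 2F 4F 1F ((full 4F 2F 0F 1F
     ((full 4F 5F 0F 1F ((full 3F 5F 2F 0F ((full 3F 5F 4F 0F ((full 4F 1F 2F 3F
     ((full 4F 5F 2F 0F ((move 0F (tri 1F 2F 3F ∷ tri 1F 4F 0F ∷ []) []) ∷ [])) ∷ [])) ∷ [])) ∷
     [])) ∷ [])) ∷ [])) ∷ [])) ∷ [])) ∷ [])) ∷ (full 3F 1F 4F 0F ((full 3F 2F 4F 1F []) ∷ [])) ∷
     [])) ∷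
  entry (row 0F 1F 2F) (row 0F 1F 2F) (row 0F 3F 4F) (row 1F 3F 4F)
    (full 3F 4F 1F 5F ((full 4F 3F 1F 5F ((move 0F (tri 5F 1F 2F ∷ tri 5F 2F 0F ∷ []) []) ∷ []))
     ∷ (move 1F (tri 3F 1F 5F ∷ tri 5F 2F 0F ∷ []) []) ∷ [])) ∷
  entry (row 0F 1F 2F) (row 0F 1F 3F) (row 0F 2F 3F) (row 1F 2F 3F)
    (full 3F 2F 4F 5F ((move 0F (tri 2F 4F 5F ∷ tri 4F 1F 5F ∷ tri 4F 5F 0F ∷ []) []) ∷ [])) ∷
  entry (row 0F 1F 2F) (row 0F 1F 3F) (row 0F 1F 4F) (row 2F 3F 4F)
    (full 3F 4F 2F 5F []) ∷
  entry (row 0F 1F 2F) (row 0F 1F 3F) (row 0F 2F 4F) (row 1F 3F 4F)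
    (full 3F 4F 1F 5F ((move 2F (tri 3F 4F 5F ∷ tri 5F 2F 0F ∷ []) []) ∷ [])) ∷
  entry (row 0F 1F 2F) (row 0F 1F 2F) (row 0F 1F 2F) (row 3F 4F 5F)
    (full 3F 4F 5F 0F ((full 4F 3F 5F 0F ((full 5F 3F 4F 0F ((move 0F (tri 3F 4F 0F ∷
     tri 3F 5F 0F ∷ []) []) ∷ [])) ∷ (full 4F 5F 3F 0F []) ∷ [])) ∷ (full 3F 5F 4F 0F ((move 1F
     (tri 3F 4F 0F ∷ tri 3F 5F 0F ∷ []) []) ∷ [])) ∷ (move 2F (tri 3F 5F 0F ∷ tri 5F 4F 0F ∷
     []) []) ∷ [])) ∷
  entry (row 0F 1F 2F) (row 0F 1F 2F) (row 0F 3F 4F) (row 0F 3F 4F)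
    (move 0F (tri 3F 1F 5F ∷ tri 5F 1F 2F ∷ []) ((move 0F (tri 3F 5F 1F ∷ tri 5F 1F 2F ∷ []) [])
     ∷ [])) ∷
  entry (row 0F 1F 2F) (row 0F 1F 3F) (row 0F 2F 4F) (row 0F 3F 4F)
    (move 0F (tri 2F 5F 1F ∷ tri 4F 5F 2F ∷ []) []) ∷
  entry (row 0F 1F 2F) (row 0F 1F 2F) (row 3F 4F 5F) (row 3F 4F 5F)
    (move 0F (tri 3F 0F 1F ∷ tri 3F 0F 2F ∷ []) ((move 0F (tri 3F 1F 0F ∷ tri 3F 2F 0F ∷ [])
     ((move 0F (tri 3F 2F 0F ∷ tri 3F 2F 1F ∷ []) ((move 1F (tri 3F 0F 1F ∷ tri 3F 2F 1F ∷ [])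
     ((move 1F (tri 3F 1F 0F ∷ tri 3F 2F 0F ∷ []) ((move 1F (tri 3F 0F 2F ∷ tri 3F 1F 2F ∷ [])
     ((move 0F (tri 4F 0F 1F ∷ []) ((move 0F (tri 4F 1F 0F ∷ []) ((move 0F (tri 4F 2F 0F ∷ [])
     ((move 1F (tri 4F 0F 1F ∷ []) ((move 1F (tri 4F 1F 0F ∷ []) ((move 1F (tri 4F 0F 2F ∷ [])
     ((move 2F (tri 5F 3F 0F ∷ []) ((move 0F (tri 5F 1F 0F ∷ []) ((move 0F (tri 5F 0F 1F ∷ [])
     ((move 0F (tri 5F 2F 0F ∷ []) ((move 1F (tri 5F 0F 1F ∷ []) ((move 1F (tri 5F 0F 2F ∷ [])
     ((locked false) ∷ [])) ∷ [])) ∷ [])) ∷ [])) ∷ [])) ∷ [])) ∷ [])) ∷ [])) ∷ [])) ∷ [])) ∷ []))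
     ∷ (move 3F (tri 3F 4F 1F ∷ []) []) ∷ [])) ∷ [])) ∷ [])) ∷ [])) ∷ [])) ∷ (move 0F
     (tri 3F 1F 0F ∷ tri 3F 1F 2F ∷ []) []) ∷ [])) ∷ (move 0F (tri 3F 0F 2F ∷ tri 3F 1F 2F ∷ [])
     ((move 0F (tri 3F 1F 0F ∷ tri 3F 2F 0F ∷ []) ((move 1F (tri 3F 0F 1F ∷ tri 3F 0F 2F ∷ [])
     ((move 1F (tri 3F 1F 0F ∷ tri 3F 1F 2F ∷ []) ((move 1F (tri 3F 2F 0F ∷ tri 3F 2F 1F ∷ [])
     ((move 0F (tri 4F 0F 1F ∷ []) ((move 2F (tri 3F 4F 0F ∷ []) []) ∷ (move 0F (tri 4F 1F 0F ∷
     []) ((move 0F (tri 4F 0F 2F ∷ []) ((move 1F (tri 4F 0F 1F ∷ []) ((move 1F (tri 4F 1F 0F ∷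
     []) ((move 1F (tri 4F 2F 0F ∷ []) ((move 2F (tri 3F 5F 0F ∷ []) ((move 0F (tri 5F 0F 1F ∷
     []) ((move 0F (tri 5F 0F 2F ∷ []) ((move 1F (tri 5F 0F 1F ∷ []) ((move 1F (tri 5F 1F 0F ∷
     []) ((move 1F (tri 5F 2F 0F ∷ []) ((locked true) ∷ [])) ∷ [])) ∷ [])) ∷ [])) ∷ [])) ∷ [])) ∷
     [])) ∷ [])) ∷ [])) ∷ [])) ∷ [])) ∷ [])) ∷ [])) ∷ [])) ∷ [])) ∷ [])) ∷ [])) ∷ (move 0F
     (tri 3F 0F 1F ∷ tri 3F 2F 1F ∷ []) []) ∷ [])) ∷
  entry (row 0F 1F 2F) (row 0F 1F 3F) (row 2F 4F 5F) (row 3F 4F 5F)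
    (move 0F (tri 2F 3F 0F ∷ tri 2F 3F 1F ∷ []) ((move 1F (tri 3F 0F 2F ∷ tri 3F 1F 2F ∷ [])
     ((full 3F 2F 0F 1F ((full 3F 2F 1F 0F ((move 0F (tri 2F 0F 1F ∷ []) ((move 0F (tri 2F 1F 0F
     ∷ []) ((move 0F (tri 4F 0F 2F ∷ []) ((move 0F (tri 4F 1F 0F ∷ []) ((move 0F (tri 5F 0F 2F ∷
     []) ((move 0F (tri 5F 1F 0F ∷ []) ((move 0F (tri 4F 3F 0F ∷ tri 4F 3F 1F ∷ []) ((move 0F
     (tri 5F 3F 0F ∷ tri 5F 3F 1F ∷ []) ((move 1F (tri 4F 0F 1F ∷ []) ((move 1F (tri 4F 1F 0F ∷
     []) ((move 1F (tri 4F 0F 2F ∷ []) ((move 1F (tri 5F 0F 1F ∷ []) ((move 1F (tri 5F 1F 0F ∷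
     []) ((move 1F (tri 5F 0F 2F ∷ []) ((locked false) ∷ [])) ∷ [])) ∷ [])) ∷ [])) ∷ [])) ∷ [])) ∷
     [])) ∷ [])) ∷ [])) ∷ [])) ∷ [])) ∷ [])) ∷ [])) ∷ [])) ∷ (move 1F (tri 4F 3F 0F ∷
     tri 3F 1F 0F ∷ []) ((move 2F (tri 3F 2F 0F ∷ tri 3F 4F 0F ∷ []) []) ∷ [])) ∷ [])) ∷ (move 1F
     (tri 4F 3F 0F ∷ tri 3F 0F 1F ∷ []) ((move 0F (tri 4F 1F 0F ∷ tri 4F 1F 2F ∷ []) ((move 2F
     (tri 3F 2F 1F ∷ tri 3F 4F 1F ∷ []) []) ∷ [])) ∷ [])) ∷ [])) ∷ [])) ∷ [])) ∷
  []

-- Completeness of the table up to renaming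

columns : ∀ n → List (Vec Bool n)
columns zero    = [] ∷ []
columns (suc n) = map (false ∷_) (columns n) ++ map (true ∷_) (columns n)

-- Quantifies over the vectors that are sorted with respect to the given list.
sorted : ∀ {A : Set} k → List A → (Vec A k → Bool) → Bool
sorted zero    xs       Q = Q []
sorted (suc k) []       Q = true
sorted (suc k) (x ∷ xs) Q = sorted k (x ∷ xs) (λ ys → Q (x ∷ ys)) ∧ sorted (suc k) xs Q

perms : ∀ n → List (Vec (Fin n) n)
perms zero    = [] ∷ []
perms (suc n) =
  concatMap (λ p → map (λ k → insertAt (Vec.map suc p) k zero) (allFin (suc n))) (perms n)

position : ∀ {k n} → Vec (Fin n) (suc k) → Fin n → Fin (suc k)
position (y ∷ [])      x = zero
position (y ∷ z ∷ ys) x = if x == y then zero else suc (position (z ∷ ys) x)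

inverse : ∀ {n} → Vec (Fin (suc n)) (suc n) → Vec (Fin (suc n)) (suc n)
inverse p = tabulate (position p)

inverses : ∀ {n} → Vec (Fin n) n → Vec (Fin n) n → Bool
inverses p q = all (λ i → (lookup p (lookup q i) == i) ∧ (lookup q (lookup p i) == i)) (allFin _)

agree : Bool → Bool → Bool
agree x y = if x then y else not y

eqᵇ : ∀ {n} → Vec Bool n → Vec Bool n → Bool
eqᵇ []      []      = true
eqᵇ (x ∷ v) (y ∷ w) = agree x y ∧ eqᵇ v w

-- Colours with equal columns are interchangeable, so the first match can be taken without
-- backtracking. If there is none, `d` is a mere filler: `fitting` tests the resulting assignment in
-- any case.
taking : ∀ {m} → Vec Bool 4 → List (C × Vec Bool 4) → (C → List (C × Vec Bool 4) → Vec C m) → C →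
  Vec C (suc m)
taking t []             k d = d ∷ k d []
taking t ((a , w) ∷ as) k d =
  if eqᵇ t w then a ∷ k a as else taking t as (λ x rest → k x ((a , w) ∷ rest)) d

matching : ∀ {m} → Vec (Vec Bool 4) m → List (C × Vec Bool 4) → Vec C m
matching []       as = []
matching (t ∷ ts) as = taking t as (λ _ → matching ts) 0F

threefold : Config → Bool
threefold P = all (λ i → count (λ v → if lookup v i then 1 else 0) P ≡ᵇ 3) (allFin 4)

-- A cheap invariant, to discard most entries before trying to match them.
signature : Config → ℕ
signature P = count weight P % 4096

-- Containment suffices, since a position uses its family only as an upper bound for the colours
-- present.
fits : Config → Vec (Fin 4) 4 → Vec C 6 → Config → Bool
fits P σ π N =
  all (λ a → all (λ i → not (mem P (lookup σ i) (lookup π a)) ∨ mem N i a) (allFin 4)) (allFin 6)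

fitting : Config → Entry → Vec (Fin 4) 4 → Vec C 6 → Bool
fitting P e σ π = inverses π (inverse π) ∧ inverses σ (inverse σ) ∧ fits P σ π (Entry.form e)

matched : Config → Entry → Vec (Fin 4) 4 → Vec C 6
matched P e σ =
  matching (tabulate (Entry.form e)) (map (λ a → a , Vec.map (lookup (P a)) σ) (allFin 6))

-- Comparing the levels by evaluation replaces a proof that `level` is invariant under permutations
-- of the neighbours. Permutations of the colours are covered by `count-permute`.
eligible : Config → ℕ × Entry → Bool
eligible P (s , e) =
  (s ≡ᵇ signature P) ∧ (level (Entry.form e) ≤ᵇ level P)
    ∧ any (λ σ → fitting P e σ (matched P e σ)) (perms 4)

uniform : Config → Bool
uniform P = all (λ a → all (λ i → agree (mem P 0F a) (mem P i a)) (allFin 4)) (allFin 6)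

data Classified (es : List (ℕ × Entry)) (P : Config) : Set where
  uneven  : T (not (threefold P)) → Classified es P
  rigid   : T (uniform P) → level P ≡ 5 → Classified es P
  matches : ∀ {s e} → (s , e) ∈ es → T (level (Entry.form e) ≤ᵇ level P) →
            ∀ σ π → T (fitting P e σ π) → Classified es P

opaque
  classified : List (ℕ × Entry) → Config → Bool
  classified es P = not (threefold P) ∨ (uniform P ∧ (level P ≡ᵇ 5)) ∨ any (eligible P) es

  classify : ∀ {es P} → T (classified es P) → Classified es P
  classify {es} {P} t =
    [ uneven
    , (λ p → [ (λ q → let u , l = ∧-split {uniform P} q in rigid u (ℕ.≡ᵇ⇒≡ (level P) 5 l))
             , (λ q →
                 let (s , e) , e∈ , r = any-∈ (eligible P) es q
                     _ , r′ = ∧-split {s ≡ᵇ signature P} r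
                     l , r″ = ∧-split {level (Entry.form e) ≤ᵇ level P} r′
                     σ , _ , f = any-∈ (λ σ → fitting P e σ (matched P e σ)) (perms 4) r″
                 in matches e∈ l σ (matched P e σ) f)
             ]′ (∨-split {uniform P ∧ (level P ≡ᵇ 5)} p))
    ]′ (∨-split {not (threefold P)} t)

checked : Entry → Bool
checked e = check (level (Entry.form e)) (Entry.form e) [] [] (Entry.tree e)
  ∧ (level (Entry.form e) ≤ᵇ 4) ∧ threefold (Entry.form e)

opaque
  unfolding admissible

  table-checked : all checked table ≡ true
  table-checked = refl

signed : List (ℕ × Entry)
signed = map (λ e → signature (Entry.form e) , e) table

opaque
  unfolding classified

  -- Up to the names of the colours a family is a multiset of six columns, so one sorted
  -- representative of each multiset has to be classified.
  table-complete : sorted 6 (columns 4) (λ cols → classified signed (lookup cols)) ≡ true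
  table-complete = refl

data Sorted {A : Set} : ∀ {k} → List A → Vec A k → Set where
  done : ∀ {xs} → Sorted xs []
  take : ∀ {k x xs} {ys : Vec A k} → Sorted (x ∷ xs) ys → Sorted (x ∷ xs) (x ∷ ys)
  drop : ∀ {k x xs} {ys : Vec A k} → Sorted xs ys → Sorted (x ∷ xs) ys

sorted-sound : ∀ {A : Set} {k} (xs : List A) (Q : Vec A k → Bool) → T (sorted k xs Q) →
               ∀ {ys} → Sorted xs ys → T (Q ys)
sorted-sound xs Q t done = t
sorted-sound {k = suc k} (x ∷ xs) Q t (take s) =
  sorted-sound (x ∷ xs) (λ ys → Q (x ∷ ys)) (proj₁ (∧-split {sorted k (x ∷ xs) (λ ys → Q (x ∷ ys))} t)) s
sorted-sound {k = zero} (x ∷ xs) Q t (drop done) = t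
sorted-sound {k = zero} (x ∷ y ∷ xs) Q t (drop (drop s)) = sorted-sound (y ∷ xs) Q t (drop s)
sorted-sound {k = suc k} (x ∷ xs) Q t (drop s) =
  sorted-sound xs Q (proj₂ (∧-split {sorted k (x ∷ xs) (λ ys → Q (x ∷ ys))} t)) s

take′ : ∀ {A : Set} {k} {x y : A} {xs} {ys : Vec A k} → y ≡ x → Sorted (x ∷ xs) ys →
  Sorted (x ∷ xs) (y ∷ ys)
take′ refl = take

sort : ∀ {A : Set} → DecidableEquality A → ∀ k (f : Fin k → A) xs → (∀ i → f i ∈ xs) →
       ∃ λ (π : Permutation′ k) → Sorted xs (tabulate (f ∘ (π ⟨$⟩ʳ_)))
sort _≟_ zero    f xs       f∈ = Perm.id , done
sort _≟_ (suc k) f []       f∈ = contradiction (f∈ 0F) λ ()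
sort _≟_ (suc k) f (x ∷ xs) f∈ =
  [ (λ p → let i = proj₁ p
               π , s =
                 sort _≟_ k (f ∘ PC.transpose 0F i ∘ suc) (x ∷ xs) (λ j → f∈ (PC.transpose 0F i (suc j)))
           in lift₀ π ∘ₚ transpose 0F i , take′ (proj₂ p) s)
  , (λ ∄i → let π , s = sort _≟_ (suc k) f xs (λ j → strip ∄i j (f∈ j)) in π , drop s)
  ]′ (toSum (any? (λ i → f i ≟ x)))
  where
  strip : ¬ (∃ λ i → f i ≡ x) → ∀ j → f j ∈ x ∷ xs → f j ∈ xs
  strip ∄i j (here e)  = contradiction (j , e) ∄i
  strip ∄i j (there p) = p

∈-columns : ∀ {n} (v : Vec Bool n) → v ∈ columns n
∈-columns [] = here refl
∈-columns {suc n} (true  ∷ v) = ∈-++⁺ʳ (map (false ∷_) (columns n)) (∈-map⁺ (true ∷_) (∈-columns v))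
∈-columns {suc n} (false ∷ v) = ∈-++⁺ˡ (∈-map⁺ (false ∷_) (∈-columns v))

count-permute : ∀ f P (π : Permutation′ 6) →
                count f (lookup (tabulate (P ∘ (π ⟨$⟩ʳ_)))) ≡ count f P
count-permute f P π = trans
  (Sum.sum-cong-≗ (λ a → cong f (lookup∘tabulate (P ∘ (π ⟨$⟩ʳ_)) a)))
  (sym (Sum.sum-permute (f ∘ P) π))

threefold⇒T : ∀ {P} → Threefold P → T (threefold P)
threefold⇒T {P} three =
  all-intro (λ i → count (λ v → if lookup v i then 1 else 0) P ≡ᵇ 3) (allFin 4)
  λ i → ℕ.≡⇒≡ᵇ (count (λ v → if lookup v i then 1 else 0) P) 3 (three i)

-- Sets of three colours, by exhaustion

_⇒ᵇ_ : Bool → Bool → Bool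
x ⇒ᵇ y = not x ∨ y

⇒ᵇ-elim : ∀ {x y} → T (x ⇒ᵇ y) → T x → T y
⇒ᵇ-elim {true} t _ = t

pick : Subset → C → List C → C
pick R d []       = d
pick R d (x ∷ xs) = if lookup R x then x else pick R d xs

-- The cyclic successor of `b` within `R`. On a 3-subset this is a 3-cycle, so it and its square
-- move every element: any two of the three rotations differ on every edge concerned.
rotate : Subset → C → C
rotate R b = pick R b (after b)
  where
  after : C → List C
  after 0F = 1F ∷ 2F ∷ 3F ∷ 4F ∷ 5F ∷ []
  after 1F = 2F ∷ 3F ∷ 4F ∷ 5F ∷ 0F ∷ []
  after 2F = 3F ∷ 4F ∷ 5F ∷ 0F ∷ 1F ∷ []
  after 3F = 4F ∷ 5F ∷ 0F ∷ 1F ∷ 2F ∷ []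
  after 4F = 5F ∷ 0F ∷ 1F ∷ 2F ∷ 3F ∷ []
  after 5F = 0F ∷ 1F ∷ 2F ∷ 3F ∷ 4F ∷ []

everyTriple : (Subset → Bool) → Bool
everyTriple f = all (λ R → (size R ≡ᵇ 3) ⇒ᵇ f R) (columns 6)

everyTriple-sound : ∀ f → everyTriple f ≡ true → ∀ R → size R ≡ 3 → T (f R)
everyTriple-sound f t R three =
  ⇒ᵇ-elim {size R ≡ᵇ 3} (all-∈ (λ R → (size R ≡ᵇ 3) ⇒ᵇ f R) (columns 6) (≡true⇒T t) (∈-columns R))
    (ℕ.≡⇒≡ᵇ (size R) 3 three)

turns : Subset → C → Bool
turns R b =
  lookup R b ⇒ᵇ (lookup R (rotate R b) ∧ not (rotate R b == b) ∧ not (rotate R (rotate R b) == b))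

turning : everyTriple (λ R → all (turns R) (allFin 6)) ≡ true
turning = refl

mixes : Subset → C → C → Bool
mixes R a b = (lookup R a ∧ lookup R b ∧ (rotate R a == rotate R b)) ⇒ᵇ (a == b)

mixing : everyTriple (λ R → all (λ a → all (mixes R a) (allFin 6)) (allFin 6)) ≡ true
mixing = refl

disjoint : Subset → Subset → Bool
disjoint R S =
  all (λ a → lookup R a ∨ lookup S a) (allFin 6) ⇒ᵇ
  all (λ b → lookup R b ⇒ᵇ not (lookup S b)) (allFin 6)

complementing : everyTriple (λ R → everyTriple (disjoint R)) ≡ true
complementing = refl

nontrivial : everyTriple (λ R → any (λ a → not (lookup R a)) (allFin 6)
                                ∧ any (lookup R) (allFin 6)) ≡ true
nontrivial = refl

fills : Subset → C → C → C → Bool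
fills R x y z = not (lookup R y) ∧ not (lookup R z) ∧ not (x == y) ∧ not (x == z) ∧ not (y == z)

filling : everyTriple (λ R → all (λ x → lookup R x ∨ any (λ y →
  any (fills R x y) (allFin 6)) (allFin 6)) (allFin 6)) ≡ true
filling = refl

module _ (R : Subset) (three : size R ≡ 3) where

  private
    turned : ∀ b → T (lookup R b) →
             T (lookup R (rotate R b)) × rotate R b ≢ b × rotate R (rotate R b) ≢ b
    turned b b∈ =
      let t = ⇒ᵇ-elim {lookup R b} (all-∈ (turns R) (allFin 6)
                (everyTriple-sound (λ R → all (turns R) (allFin 6)) turning R three) (∈-allFin b)) b∈
          p , t′ = ∧-split {lookup R (rotate R b)} t
          q , r  = ∧-split {not (rotate R b == b)} t′
      in p , ≠⇒≢ q , ≠⇒≢ r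

  rotate-∈ : ∀ {b} → T (lookup R b) → T (lookup R (rotate R b))
  rotate-∈ {b} b∈ = proj₁ (turned b b∈)

  rotate-≢ : ∀ {b} → T (lookup R b) → rotate R b ≢ b
  rotate-≢ {b} b∈ = proj₁ (proj₂ (turned b b∈))

  rotate²-≢ : ∀ {b} → T (lookup R b) → rotate R (rotate R b) ≢ b
  rotate²-≢ {b} b∈ = proj₂ (proj₂ (turned b b∈))

  rotate-injective : ∀ {a b} → T (lookup R a) → T (lookup R b) → rotate R a ≡ rotate R b → a ≡ b
  rotate-injective {a} {b} a∈ b∈ e = ==⇒≡ (⇒ᵇ-elim
    {lookup R a ∧ lookup R b ∧ (rotate R a == rotate R b)}
    (all-∈ (mixes R a) (allFin 6) (all-∈ (λ a → all (mixes R a) (allFin 6)) (allFin 6)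
      (everyTriple-sound (λ R → all (λ a → all (mixes R a) (allFin 6)) (allFin 6)) mixing R three)
      (∈-allFin a)) (∈-allFin b))
    (∧-intro a∈ (∧-intro b∈ (subst (λ x → T (rotate R a == x)) e (==-refl (rotate R a))))))

  -- Two sets of size 3 that cover all six colours leave no room for a common element.
  complement : ∀ S → size S ≡ 3 → (∀ a → T (lookup R a ∨ lookup S a)) →
               ∀ b → T (lookup R b) → ¬ T (lookup S b)
  complement S three′ covers b b∈ =
    T-not (⇒ᵇ-elim {lookup R b} (all-∈ (λ b → lookup R b ⇒ᵇ not (lookup S b)) (allFin 6)
    (⇒ᵇ-elim {all (λ a → lookup R a ∨ lookup S a) (allFin 6)}
      (everyTriple-sound (disjoint R)
        (T⇒≡true (everyTriple-sound (λ R → everyTriple (disjoint R)) complementing R three)) S three′)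
      (all-intro (λ a → lookup R a ∨ lookup S a) (allFin 6) covers)) (∈-allFin b)) b∈)

  absentee : ∃ λ a → T (not (lookup R a))
  absentee =
    let t , _ = ∧-split {any (λ a → not (lookup R a)) (allFin 6)} (everyTriple-sound
          (λ R → any (λ a → not (lookup R a)) (allFin 6) ∧ any (lookup R) (allFin 6)) nontrivial R three)
        a , _ , p = any-∈ (λ a → not (lookup R a)) (allFin 6) t
    in a , p

  member : ∃ λ b → T (lookup R b)
  member =
    let _ , t = ∧-split {any (λ a → not (lookup R a)) (allFin 6)} (everyTriple-sound
          (λ R → any (λ a → not (lookup R a)) (allFin 6) ∧ any (lookup R) (allFin 6)) nontrivial R three)
        b , _ , p = any-∈ (lookup R) (allFin 6) t
    in b , p

  others : ∀ {x} → T (not (lookup R x)) → ∃ λ y → ∃ λ z →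
           T (not (lookup R y)) × T (not (lookup R z)) × x ≢ y × x ≢ z × y ≢ z
  others {x} x∉ =
    let fill = λ (R : Subset) x → any (λ y → any (fills R x y) (allFin 6)) (allFin 6)
        t = [ (λ p → contradiction p (T-not x∉)) , id ]′ (∨-split {lookup R x}
              (all-∈ (λ x → lookup R x ∨ fill R x) (allFin 6)
                (everyTriple-sound (λ R → all (λ x → lookup R x ∨ fill R x) (allFin 6)) filling R three)
                (∈-allFin x)))
        y , _ , t′ = any-∈ (λ y → any (fills R x y) (allFin 6)) (allFin 6) t
        z , _ , t″ = any-∈ (fills R x y) (allFin 6) t′
        y∉ , u = ∧-split {not (lookup R y)} t″
        z∉ , u′ = ∧-split {not (lookup R z)} u
        xy , u″ = ∧-split {not (x == y)} u′
        xz , yz = ∧-split {not (x == z)} u″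
    in y , z , y∉ , z∉ , ≠⇒≢ xy , ≠⇒≢ xz , ≠⇒≢ yz

∨-default : ∀ x {y} → (x ≡ false → T y) → T (x ∨ y)
∨-default true  f = _
∨-default false f = f refl

agree⇒≡ : ∀ {x y} → T (agree x y) → x ≡ y
agree⇒≡ {true}  {true}  _ = refl
agree⇒≡ {false} {false} _ = refl

Uniform : Config → Set
Uniform P = ∀ i a → mem P i a ≡ mem P 0F a

uniform-sound : ∀ {P} → T (uniform P) → Uniform P
uniform-sound {P} t i a = sym (agree⇒≡ (all-∈ (λ i → agree (mem P 0F a) (mem P i a)) (allFin 4)
  (all-∈ (λ a → all (λ i → agree (mem P 0F a) (mem P i a)) (allFin 4)) (allFin 6) t (∈-allFin a))
  (∈-allFin i)))

from-inverses : ∀ {n} (p q : Vec (Fin n) n) → T (inverses p q) → Permutation′ n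
from-inverses p q t = permutation (lookup p) (lookup q)
  (λ i → ==⇒≡ (proj₁ (both i))) (λ i → ==⇒≡ (proj₂ (both i)))
  where
  both : ∀ i → T (lookup p (lookup q i) == i) × T (lookup q (lookup p i) == i)
  both i = ∧-split {lookup p (lookup q i) == i}
    (all-∈ (λ i → (lookup p (lookup q i) == i) ∧ (lookup q (lookup p i) == i)) (allFin _) t (∈-allFin i))

T⇒threefold : ∀ {P} → T (threefold P) → Threefold P
T⇒threefold {P} t i = ℕ.≡ᵇ⇒≡ (count (λ v → if lookup v i then 1 else 0) P) 3
  (all-∈ (λ i → count (λ v → if lookup v i then 1 else 0) P ≡ᵇ 3) (allFin 4) t (∈-allFin i))

rowOf : Config → Fin 4 → Subset
rowOf P i = tabulate (mem P i)

rowOf-lookup : ∀ P i a → lookup (rowOf P i) a ≡ mem P i a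
rowOf-lookup P i a = lookup∘tabulate (mem P i) a

rowOf-size : ∀ {P} → Threefold P → ∀ i → size (rowOf P i) ≡ 3
rowOf-size {P} three i =
  trans (Sum.sum-cong-≗ (λ a → cong (λ b → if b then 1 else 0) (rowOf-lookup P i a))) (three i)

options : List (Maybe C)
options = nothing ∷ map just (allFin 6)

∈-options : ∀ m → m ∈ options
∈-options nothing  = here refl
∈-options (just a) = there (∈-map⁺ just (∈-allFin a))

admits : Subset → Maybe C → Bool
admits S nothing  = true
admits S (just a) = lookup S a

is : C → Maybe C → Bool
is x nothing  = false
is x (just a) = x == a

spans : Maybe C → Maybe C → Maybe C → C → Subset → Bool
spans l m r x S =
  admits S l ∧ admits S m ∧ admits S r ∧ (is x l ∨ is x m ∨ is x r ∨ not (lookup S x))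

spanned : Maybe C → Maybe C → Maybe C → C → Bool
spanned l m r x = any (spans l m r x) triples

-- At most three colours are to be included and one further colour avoided; the six colours leave
-- enough others to complete a triple.
all-spanned : all (λ l → all (λ m → all (λ r → all (spanned l m r) (allFin 6)) options) options)
                options ≡ true
all-spanned = refl

span : ∀ l m r x → T (spanned l m r x)
span l m r x =
  all-∈ (spanned l m r) (allFin 6)
    (all-∈ (λ r → all (spanned l m r) (allFin 6)) options
      (all-∈ (λ m → all (λ r → all (spanned l m r) (allFin 6)) options) options
        (all-∈ (λ l → all (λ m → all (λ r → all (spanned l m r) (allFin 6)) options) options)
          options (≡true⇒T all-spanned) (∈-options l)) (∈-options m)) (∈-options r)) (∈-allFin x)

is⇒≡ : ∀ {x m} → T (is x m) → m ≡ just x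
is⇒≡ {m = just a} t = cong just (sym (==⇒≡ t))

-- Renaming the colours of a partial colouring

module Relabelling {n : ℕ} (G : Graph n) where
  open Walks G

  relabel : Permutation′ 6 → Partial → Partial
  relabel π c x y = Maybe.map (π ⟨$⟩ˡ_) (c x y)

  module _ (π : Permutation′ 6) (c : Partial) where

    relabel-just : ∀ {x y a} → c x y ≡ just a → relabel π c x y ≡ just (π ⟨$⟩ˡ a)
    relabel-just e = cong (Maybe.map (π ⟨$⟩ˡ_)) e

    unrelabel : ∀ {x y a} → relabel π c x y ≡ just a → c x y ≡ just (π ⟨$⟩ʳ a)
    unrelabel {x} {y} e with c x y
    unrelabel refl | just b = cong just (sym (inverseʳ π))

    relabel-walk : ∀ {k a b x a′ b′ y} → Walk c k a b x a′ b′ y →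
      Walk (relabel π c) k (π ⟨$⟩ˡ a) (π ⟨$⟩ˡ b) x (π ⟨$⟩ˡ a′) (π ⟨$⟩ˡ b′) y
    relabel-walk []      = []
    relabel-walk (e ∷ w) = relabel-just e ∷ relabel-walk w

    relabel-valid : Valid c → Valid (relabel π c)
    relabel-valid ok = record
      { symm   = λ x y → cong (Maybe.map (π ⟨$⟩ˡ_)) (symm x y)
      ; edge   = λ e → edge (unrelabel e)
      ; proper = λ e e′ → proper (unrelabel e) (unrelabel e′)
      ; halts  =
        λ {a} {b} a≢b x → subst₂ (λ a b → Halts (relabel π c) a b x) (inverseˡ π) (inverseˡ π)
          (halts′ (halts (λ e → a≢b (trans (sym (inverseˡ π)) (trans (cong (π ⟨$⟩ˡ_) e) (inverseˡ π)))) x)) }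
      where
      open Valid ok
      halts′ : ∀ {a b x} → Halts c a b x → Halts (relabel π c) (π ⟨$⟩ˡ a) (π ⟨$⟩ˡ b) x
      halts′ (halting w s) = halting (relabel-walk w)
        λ y e → s y (trans (unrelabel e) (cong just (inverseʳ π)))

-- Neighbourhoods

module Positions {n : ℕ} (G : Graph n) (regular : Regular 4 G) where
  open Walks G

  record Nbrs {k} (v : V) (us : Fin k → V) : Set where
    field
      adjacent  : ∀ i → Adj G v (us i)
      injective : ∀ {i j} → us i ≡ us j → i ≡ j
      onto      : ∀ {y} → Adj G v y → ∃ λ i → us i ≡ y

  opaque
    nbrs : ∀ v → ∃ (Nbrs {4} v)
    nbrs v = subst (λ k → ∃ (Nbrs {k} v)) (trans (sym (count-filter (allFin n))) (regular v))
      (List.lookup ns , record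
        { adjacent  = λ i → proj₂ (∈-filter⁻ adjacent? {xs = allFin n} (∈-lookup i))
        ; injective = lookup-injective (Unique.filter⁺ adjacent? (Unique.allFin⁺ n))
        ; onto      = λ e → let p = ∈-filter⁺ adjacent? (∈-allFin _) e
                            in index p , sym (lookup-index p) })
      where
      adjacent? : ∀ w → Dec (Adj G v w)
      adjacent? w = adj G v w Bool.≟ true

      ns : List V
      ns = filter adjacent? (allFin n)

      count-filter : ∀ xs → sum (map (λ w →
        if adj G v w then 1 else 0) xs) ≡ length (filter adjacent? xs)
      count-filter [] = refl
      count-filter (x ∷ xs) with adj G v x
      ... | true  = cong suc (count-filter xs)
      ... | false = count-filter xs

  permuted : ∀ {v us} (π : Permutation′ 4) → Nbrs v us → Nbrs v (us ∘ (π ⟨$⟩ʳ_))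
  permuted {us = us} π nb = record
    { adjacent  = λ i → adjacent (π ⟨$⟩ʳ i)
    ; injective = λ e → trans (sym (inverseˡ π)) (trans (cong (π ⟨$⟩ˡ_) (injective e)) (inverseˡ π))
    ; onto      = λ e → let i , p = onto e in π ⟨$⟩ˡ i , trans (cong us (inverseʳ π)) p }
    where open Nbrs nb

  opaque
    -- `t` prescribes the neighbour for some of the four places; it is partial because an edge of a
    -- given colour may be missing. Each prescription is met by a transposition, which leaves the
    -- earlier ones intact since different places have different targets.
    arrange : ∀ {v} {us : Fin 4 → V} → Nbrs v us → (t : Fin 4 → V → Set) → (∀ k → Dec (∃ (t k))) →
              (∀ {k w} → t k w → Adj G v w) → (∀ {k w w′} → t k w → t k w′ → w ≡ w′) →
              (∀ {k l w} → t k w → t l w → k ≡ l) →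
              ∃ λ (us′ : Fin 4 → V) → Nbrs v us′ × ∀ {k w} → t k w → us′ k ≡ w
    arrange {v} {us} nb t t? adjacent functional injective =
      let us′ , nb′ , ok = go (allFin 4) in us′ , nb′ , ok (∈-allFin _)
      where
      go : ∀ ks → ∃ λ (us′ : Fin 4 → V) → Nbrs v us′ × ∀ {k w} → k ∈ ks → t k w → us′ k ≡ w
      go [] = us , nb , λ ()
      go (k ∷ ks) with go ks | t? k
      ... | us′ , nb′ , ok | no ∄w = us′ , nb′ , λ where
            (here refl) tw → contradiction (_ , tw) ∄w
            (there k∈) tw → ok k∈ tw
      ... | us′ , nb′ , ok | yes (w , tw) with Nbrs.onto nb′ (adjacent tw)
      ... | m , refl = us′ ∘ PC.transpose k m , permuted (transpose k m) nb′ , ok′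
        where
        ok′ : ∀ {l w} → l ∈ k ∷ ks → t l w → us′ (PC.transpose k m l) ≡ w
        ok′ {l} l∈ tl with l ≟ k
        ... | yes refl = functional tw tl
        ok′ {l} (here l≡k) tl | no l≢k = contradiction l≡k l≢k
        ok′ {l} (there l∈) tl | no l≢k with l ≟ m
        ... | yes refl = contradiction (injective (subst (t l) (sym (ok l∈ tl)) tl) tw) l≢k
        ... | no _ = ok l∈ tl

  record Cover (c : Partial) (x : C) (w : V) : Set where
    field
      subset  : Subset
      triple  : subset ∈ triples
      present : ∀ {a y} → c w y ≡ just a → T (lookup subset a)
      absent  : Stuck c x w → ¬ T (lookup subset x)

  opaque
    -- One of the four edges at `w` is uncoloured, so at most three colours occur there, and some
    -- triple contains them while avoiding `x` unless `x` itself occurs.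
    cover : ∀ {c w y} → Valid c → Adj G w y → c w y ≡ nothing → ∀ x → Cover c x w
    cover {c} {w} {y} ok e none x with nbrs w
    ... | us , nb with Nbrs.onto nb e
    ... | i , refl with any-∈ _ triples
      (span (c w (us (punchIn i 0F))) (c w (us (punchIn i 1F))) (c w (us (punchIn i 2F))) x)
    ... | S , S∈ , t with ∧-split {admits S (c w (us (punchIn i 0F)))} t
    ... | t₀ , t′ with ∧-split {admits S (c w (us (punchIn i 1F)))} t′
    ... | t₁ , t″ with ∧-split {admits S (c w (us (punchIn i 2F)))} t″
    ... | t₂ , t₃ = record { subset = S ; triple = S∈ ; present = present ; absent = absent }
      where
      admitted : ∀ k → T (admits S (c w (us (punchIn i k))))
      admitted 0F = t₀
      admitted 1F = t₁
      admitted 2F = t₂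
      present : ∀ {a z} → c w z ≡ just a → T (lookup S a)
      present {a} {z} f with Nbrs.onto nb (Valid.edge ok f)
      ... | j , refl with i ≟ j
      ... | yes refl = contradiction (trans (sym f) none) λ ()
      ... | no i≢j = subst (T ∘ admits S)
        (trans (cong (c w ∘ us) (punchIn-punchOut i≢j)) f) (admitted (punchOut i≢j))
      absent : Stuck c x w → ¬ T (lookup S x)
      absent st with ∨-split {is x (c w (us (punchIn i 0F)))} t₃
      ... | inj₁ p = contradiction (is⇒≡ p) (st _)
      ... | inj₂ p with ∨-split {is x (c w (us (punchIn i 1F)))} p
      ... | inj₁ q = contradiction (is⇒≡ q) (st _)
      ... | inj₂ q with ∨-split {is x (c w (us (punchIn i 2F)))} q
      ... | inj₁ r = contradiction (is⇒≡ r) (st _)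
      ... | inj₂ r = T-not r

-- Positions with one missing vertex

module Game {n : ℕ} (G : Graph n) (regular : Regular 4 G) (triangleFree : TriangleFree G)
            (Wanted : Fin n → Fin n → Set) (wanted-adjacent : ∀ {x y} → Wanted x y →
              Adj G x y) where
  open Walks G
  open Positions G regular
  open Relabelling G
  open Entry using (form; row₀; tree)

  Goal : Set
  Goal = ∃ λ c → Valid c × (∀ {x y} → Wanted x y → ∃ λ a → c x y ≡ just a)

  record Position (v : V) (c : Partial) (us : Fin 4 → V) (P : Config) : Set where
    field
      valid    : Valid c
      isolated : Isolated c v
      coloured : ∀ {x y} → Wanted x y → x ≢ v → y ≢ v → ∃ λ a → c x y ≡ just a
      around   : Nbrs v us
      covers   : ∀ i {a y} → c (us i) y ≡ just a → T (mem P i a)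

  Won : ℕ → Set
  Won b = ∀ {v c us P} → Position v c us P → Threefold P → T (level P <ᵇ b) → Goal

  spokes : (Fin 4 → V) → Spokes → V → Maybe C
  spokes us []             y = nothing
  spokes us ((i , a) ∷ st) y with us i ≟ y
  ... | yes _ = just a
  ... | no _  = spokes us st y

  spokes-just : ∀ us st {y a} → spokes us st y ≡ just a → ∃ λ i → (i , a) ∈ st × us i ≡ y
  spokes-just us ((i , a) ∷ st) {y} e with us i ≟ y
  spokes-just us ((i , a) ∷ st) refl | yes p = i , here refl , p
  ... | no _ = let j , j∈ , p = spokes-just us st e in j , there j∈ , p

  spokes-cover : ∀ us st {i a} → (i , a) ∈ st → ∃ λ b → spokes us st (us i) ≡ just b
  spokes-cover us ((j , b) ∷ st) {i} i∈ with us j ≟ us i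
  ... | yes _ = b , refl
  spokes-cover us ((j , b) ∷ st) (here refl) | no j≢j = contradiction refl j≢j
  spokes-cover us ((j , b) ∷ st) (there i∈)  | no _   = spokes-cover us st i∈

  -- Links and moves in a fixed position

  module At {v c us P} (pos : Position v c us P) where
    open Position pos
    open Valid valid
    open Nbrs around

    Linked : Fact → Set
    Linked (fact i j a b) = ∃ λ k → Walk c k b a (us i) b a (us j)

    -- That `colour₂` is free at the second port makes a link a maximal walk, hence decidable and
    -- with a unique end. That `colour₁` is free at the first port gives the same for the flipped
    -- fact.
    record Candidate (f : Fact) : Set where
      constructor candidate
      open Fact f
      field
        ports≢   : port₁ ≢ port₂
        colours≢ : colour₁ ≢ colour₂
        stuck₁   : Stuck c colour₁ (us port₁)
        stuck₂   : Stuck c colour₂ (us port₂)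
    open Candidate

    Holds : Fact → Set
    Holds f = Candidate f × Linked f

    flip-holds : ∀ {f} → Holds f → Holds (flip f)
    flip-holds (candidate p q s t , k , w) =
      candidate (p ∘ sym) (q ∘ sym) t s , k , reverse valid w

    splits-absurd : ∀ {f g} → T (splits f g) → Holds f → ¬ Holds g
    splits-absurd {fact i j a b} {fact i′ j′ a′ b′} t (cf , _ , w) (cg , _ , w′)
      with i≡ , t ← ∧-split {i == i′} t
      with a≡ , t ← ∧-split {a == a′} t
      with b≡ , j≢ ← ∧-split {b == b′} t
      with refl ← ==⇒≡ {i = i} i≡
      with refl ← ==⇒≡ {i = a} a≡
      with refl ← ==⇒≡ {i = b} b≡
      = ≠⇒≢ {i = j} j≢ (injective (proj₂ (deterministic valid w (stuck₂ cf) w′ (stuck₂ cg))))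

    clash-absurd : ∀ {f g} → T (clash f g) → Holds f → ¬ Holds g
    clash-absurd {f} {g} t hf hg with ∨-split {splits f g} t
    ... | inj₁ p = splits-absurd {f} {g} p hf hg
    ... | inj₂ t with ∨-split {splits f (flip g)} t
    ... | inj₁ p = splits-absurd {f} {flip g} p hf (flip-holds hg)
    ... | inj₂ t with ∨-split {splits (flip f) g} t
    ... | inj₁ p = splits-absurd {flip f} {g} p (flip-holds hf) hg
    ... | inj₂ p = splits-absurd {flip f} {flip g} p (flip-holds hf) (flip-holds hg)

    same⇒≡ : ∀ {f g} → T (same f g) → f ≡ g
    same⇒≡ {fact i j a b} {fact i′ j′ a′ b′} t
      with i≡ , t ← ∧-split {i == i′} t
      with j≡ , t ← ∧-split {j == j′} t
      with a≡ , b≡ ← ∧-split {a == a′} t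
      with refl ← ==⇒≡ {i = i} i≡
      with refl ← ==⇒≡ {i = j} j≡
      with refl ← ==⇒≡ {i = a} a≡
      with refl ← ==⇒≡ {i = b} b≡ = refl

    refuted-sound : ∀ {yes no f} → T (refuted yes no f) → All Holds yes → All (¬_ ∘ Linked) no →
                    Candidate f → ¬ Linked f
    refuted-sound {ys} {ns} {f} t hs ¬hs cf l with ∨-split {any (same f) ns} t
    ... | inj₁ p = let g , g∈ , q = any-∈ (same f) ns p in
          All.lookup ¬hs g∈ (subst Linked (same⇒≡ {f} {g} q) l)
    ... | inj₂ p = let g , g∈ , q = any-∈ (clash f) ys p in
          clash-absurd {f} {g} q (cf , l) (All.lookup hs g∈)

    free : ∀ {i a} → T (not (mem P i a)) → Stuck c a (us i)
    free {i} t y e = T-not t (covers i e)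

    Free : Fin 4 × C → Set
    Free (i , a) = Stuck c a (us i)

    Apart : Fin 4 × C → Fin 4 × C → Set
    Apart (i , a) (j , b) = i ≢ j × a ≢ b × ¬ Linked (fact i j a b)

    separate-sound : ∀ {p q} → T (separate p q) → proj₁ p ≢ proj₁ q × proj₂ p ≢ proj₂ q
    separate-sound {i , a} {j , b} t with ∧-split {not (i == j)} t
    ... | s , t = ≠⇒≢ s , ≠⇒≢ t

    suitable-free : ∀ st → T (suitable P st) → All Free st
    suitable-free []             t = []
    suitable-free ((i , a) ∷ st) t with ∧-split {not (mem P i a)} t
    ... | s , t = free s ∷ suitable-free st (proj₂ (∧-split {all (separate (i , a)) st} t))

    candidatesWith : ∀ p st → Free p → T (all (separate p) st) → All Free st →
                     All Candidate (conflictsWith P p st)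
    candidatesWith p [] s t ss = []
    candidatesWith p@(i , a) (q@(j , b) ∷ st) s t (s′ ∷ ss) with ∧-split {separate p q} t
    ... | t , ts = ++⁺ here-it (candidatesWith p st s ts ss)
      where
      here-it : All Candidate (conflict P p q)
      here-it with mem P i b ∧ mem P j a
      ... | true  = let i≢j , a≢b = separate-sound {p} {q} t in candidate i≢j a≢b s s′ ∷ []
      ... | false = []

    candidates : ∀ st → T (suitable P st) → All Candidate (conflicts P st)
    candidates []               t = []
    candidates (p@(i , a) ∷ st) t with ∧-split {not (mem P i a)} t
    ... | s , t with ∧-split {all (separate p) st} t
    ... | t₁ , t₂ = ++⁺ (candidatesWith p st (free s) t₁ (suitable-free st t₂)) (candidates st t₂)

    apartWith : ∀ p st → T (all (separate p) st) → All (¬_ ∘ Linked) (conflictsWith P p st) →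
                All (Apart p) st
    apartWith p [] t ls = []
    apartWith p@(i , a) (q@(j , b) ∷ st) t ls with ∧-split {separate p q} t
    ... | t , ts = (i≢j , a≢b , unlinked) ∷ apartWith p st ts (++⁻ʳ (conflict P p q) ls)
      where
      i≢j = proj₁ (separate-sound {p} {q} t)
      a≢b = proj₂ (separate-sound {p} {q} t)
      unlinked : ¬ Linked (fact i j a b)
      unlinked (k , w) with mem P i b in eqᵢ | mem P j a in eqⱼ | ++⁻ˡ (conflict P p q) ls
      ... | true | true | l ∷ [] = l (k , w)
      ... | true | false | _ =
        let _ , e = departs (reverse valid w) (i≢j ∘ sym ∘ injective) in subst T eqⱼ (covers j e)
      ... | false | _ | _ = let _ , e = departs w (i≢j ∘ injective) in subst T eqᵢ (covers i e)

    apart : ∀ st → T (suitable P st) → All (¬_ ∘ Linked) (conflicts P st) → AllPairs Apart st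
    apart []               t ls = []
    apart (p@(i , a) ∷ st) t ls with ∧-split {not (mem P i a)} t
    ... | s , t with ∧-split {all (separate p) st} t
    ... | t₁ , t₂ = apartWith p st t₁ (++⁻ˡ (conflictsWith P p st) ls)
                    ∷ apart st t₂ (++⁻ʳ (conflictsWith P p st) ls)

    -- In a move the spokes are attached to a smaller colouring `d`, while links are decided in `c`.
    -- Every link of `d` is one of `c`, so this is enough.
    star : ∀ {d} st → (∀ {x y a} → d x y ≡ just a → c x y ≡ just a) →
           All Free st → AllPairs Apart st → Star d v (spokes us st)
    star {d} st sub fs as = record
      { adjacent = λ e → let i , _ , p = spokes-just us st e in subst (Adj G v) p (adjacent i)
      ; rainbow  = rainbow
      ; free     = λ e y e′ → let i , i∈ , p = spokes-just us st e in
          All.lookup fs i∈ y (trans (cong (λ u → c u y) p) (sub e′))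
      ; unlinked = unlinked }
      where
      rainbow : ∀ {y z a} → spokes us st y ≡ just a → spokes us st z ≡ just a → y ≡ z
      rainbow e e′ with spokes-just us st e | spokes-just us st e′
      ... | i , i∈ , refl | j , j∈ , refl with pair-∈ as i∈ j∈
      ... | inj₁ refl = refl
      ... | inj₂ (inj₁ (_ , a≢a , _)) = contradiction refl a≢a
      ... | inj₂ (inj₂ (_ , a≢a , _)) = contradiction refl a≢a
      widen : ∀ {k a b x a′ b′ y} → Walk d k a b x a′ b′ y → Walk c k a b x a′ b′ y
      widen []      = []
      widen (e ∷ w) = sub e ∷ widen w
      unlinked : ∀ {p q a b} → spokes us st p ≡ just a → spokes us st q ≡ just b → p ≢ q →
                 ∀ {k} → ¬ Walk d k b a p b a q
      unlinked e e′ p≢q w with spokes-just us st e | spokes-just us st e′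
      ... | i , i∈ , refl | j , j∈ , refl with pair-∈ as i∈ j∈
      ... | inj₁ refl = p≢q refl
      ... | inj₂ (inj₁ (_ , _ , ¬l)) = ¬l (_ , widen w)
      ... | inj₂ (inj₂ (_ , _ , ¬l)) = ¬l (_ , reverse valid (widen w))

    finish : ∀ {a b c d} → All Free (wheel a b c d) → AllPairs Apart (wheel a b c d) → Goal
    finish {p} {q} {r} {s} fs as =
      extend c v s′ , extend-valid valid isolated (star st (λ e → e) fs as) , total
      where
      st = wheel p q r s
      s′ = spokes us st
      port : ∀ i → ∃ λ a → (i , a) ∈ st
      port 0F = p , here refl
      port 1F = q , there (here refl)
      port 2F = r , there (there (here refl))
      port 3F = s , there (there (there (here refl)))
      spoke : ∀ {y} → Adj G v y → ∃ λ a → s′ y ≡ just a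
      spoke e with onto e
      ... | i , refl = spokes-cover us st (proj₂ (port i))
      total : ∀ {x y} → Wanted x y → ∃ λ a → extend c v s′ x y ≡ just a
      total {x} {y} w with x ≟ v | y ≟ v
      ... | yes refl | _ = spoke (wanted-adjacent w)
      ... | no _ | yes refl = spoke (Adj-sym (wanted-adjacent w))
      ... | no x≢v | no y≢v = coloured w x≢v y≢v

    u≢v : ∀ i → us i ≢ v
    u≢v i e = Adj-irrefl (subst (Adj G v) e (adjacent i))

    rim-≢ : ∀ i st {j a} → (j , a) ∈ rim i st → j ≢ i
    rim-≢ i (_ ∷ _ ∷ _ ∷ []) (here refl)                 = punchInᵢ≢i i 0F
    rim-≢ i (_ ∷ _ ∷ _ ∷ []) (there (here refl))         = punchInᵢ≢i i 1F
    rim-≢ i (_ ∷ _ ∷ _ ∷ []) (there (there (here refl))) = punchInᵢ≢i i 2F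

    rim-cover : ∀ i st {j} → j ≢ i → ∃ λ a → (j , a) ∈ rim i st
    rim-cover i (a ∷ b ∷ c ∷ []) {j} j≢i with punchOut (j≢i ∘ sym) | punchIn-punchOut (j≢i ∘ sym)
    ... | 0F | refl = a , here refl
    ... | 1F | refl = b , there (here refl)
    ... | 2F | refl = c , there (there (here refl))

    rim-colour : ∀ i st {j a} → (j , a) ∈ rim i st → T (lookup (colourSet st) a)
    rim-colour i (a ∷ b ∷ c ∷ []) {j} {x} j∈ = subst T
      (sym (lookup∘tabulate (λ x → (x == a) ∨ (x == b) ∨ (x == c) ∨ false) x)) (go j∈)
      where
      go : (j , x) ∈ rim i (a ∷ b ∷ c ∷ []) → T ((x == a) ∨ (x == b) ∨ (x == c) ∨ false)
      go (here refl) = ∨-introˡ (==-refl a)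
      go (there (here refl)) = ∨-introʳ (x == a) (∨-introˡ (==-refl b))
      go (there (there (here refl))) = ∨-introʳ (x == a) (∨-introʳ (x == b) (∨-introˡ (==-refl c)))

    module Hop (i : Fin 4) (st : Vec C 3) (fs : All Free (rim i st))
               (as : AllPairs Apart (rim i st)) where

      private
        u : V
        u = us i
        d : Partial
        d = erase c u
        s : V → Maybe C
        s = spokes us (rim i st)

      hopped : Partial
      hopped = extend d v s

      hopped-valid : Valid hopped
      hopped-valid = extend-valid (erase-valid u valid) (erase-keeps {c} {u} isolated)
        (star (rim i st) (λ {x} {y} → erase⊆ c u {x} {y}) fs as)

      private
        s-u : s u ≡ nothing
        s-u with s u in eq
        ... | nothing = refl
        ... | just _ = let j , j∈ , p = spokes-just us (rim i st) eq in
                       contradiction (injective p) (rim-≢ i st j∈)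

        spoke : ∀ {y} → Adj G v y → y ≢ u → ∃ λ a → s y ≡ just a
        spoke e y≢u with onto e
        ... | j , refl = spokes-cover us (rim i st) (proj₂ (rim-cover i st (y≢u ∘ cong us)))

      hopped-isolated : Isolated hopped u
      hopped-isolated y = case y ≟ v of λ where
        (yes y≡v) → subst (λ y → hopped u y ≡ nothing) (sym y≡v) (trans (extend-ʳ d v s u) s-u)
        (no y≢v)  → trans (extend-≢ d s (u≢v i) y≢v) (erase-isolated c u y)

      hopped-coloured : ∀ {x y} → Wanted x y → x ≢ u → y ≢ u → ∃ λ a → hopped x y ≡ just a
      hopped-coloured {x} {y} w x≢u y≢u with x ≟ v | y ≟ v
      ... | yes refl | _ = spoke (wanted-adjacent w) y≢u
      ... | no _ | yes refl = spoke (Adj-sym (wanted-adjacent w)) x≢u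
      ... | no x≢v | no y≢v =
        let a , e = coloured w x≢v y≢v in a , trans (erase-≢ c x≢u y≢u) e

      hopped-centre : ∀ {a y} → hopped v y ≡ just a → T (lookup (colourSet st) a)
      hopped-centre {y = y} e =
        let j , j∈ , _ = spokes-just us (rim i st) (trans (sym (extend-ˡ d v s y)) e)
        in rim-colour i st j∈

      -- Both `v` and `w` are adjacent to `u`, so without triangles they are not adjacent to each
      -- other, and the new spokes at `v` add no colour at `w`.
      hopped-outer : ∀ {w} → Adj G u w → w ≢ v → ∀ {a y} → hopped w y ≡ just a → d w y ≡ just a
      hopped-outer {w} u~w w≢v {a} {y} e = case y ≟ v of λ where
        (no y≢v)  → trans (sym (extend-≢ d s w≢v y≢v)) e
        (yes y≡v) →
          let j , _ , p = spokes-just us (rim i st)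
                (trans (sym (extend-ʳ d v s w)) (subst (λ y → hopped w y ≡ just a) y≡v e))
          in ⊥-elim (triangleFree v u w (adjacent i , u~w ,
               Adj-sym (subst (Adj G v) p (adjacent j))))

    need-sound : ∀ i x f {y} → Holds f → y ∈ need i x f →
                 ∃ λ w → ∃ λ z → c (us i) w ≡ just x × c w z ≡ just y × x ≢ y
    need-sound i x (fact j j′ a b) (cf , _ , w) y∈ with (i == j) ∧ (x == b) in eq
    need-sound i x (fact j j′ a b) (cf , _ , w) (here refl) | true
      with i≡ , x≡ ← ∧-split {i == j} (≡true⇒T eq)
      with refl ← ==⇒≡ {i = i} i≡ with refl ← ==⇒≡ {i = x} x≡
      = let w , z , e , e′ = departs² w (colours≢ cf ∘ sym) (ports≢ cf ∘ injective)
        in w , z , e , e′ , colours≢ cf ∘ sym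

    needs-sound : ∀ fs i x {y} → All Holds fs → y ∈ needs fs i x →
                  ∃ λ w → ∃ λ z → c (us i) w ≡ just x × c w z ≡ just y × x ≢ y
    needs-sound (f ∷ fs) i x (h ∷ hs) y∈ with ∈-++⁻ (need i x f) y∈
    ... | inj₁ p = need-sound i x f h p
    ... | inj₂ p with ∈-++⁻ (need i x (flip f)) p
    ... | inj₁ q = need-sound i x (flip f) (flip-holds h) q
    ... | inj₂ q = needs-sound fs i x hs q

    module Around (i : Fin 4) (xs : Fin 3 → C) (xs-injective : ∀ {k l} → xs k ≡ xs l → k ≡ l) where

      private
        u : V
        u = us i

        target : Fin 4 → V → Set
        target zero    w = w ≡ v
        target (suc k) w = c u w ≡ just (xs k)

        target? : ∀ k → Dec (∃ (target k))
        target? zero    = yes (v , refl)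
        target? (suc k) = any? (λ w → Maybe.≡-dec _≟_ (c u w) (just (xs k)))

        target-adjacent : ∀ {k w} → target k w → Adj G u w
        target-adjacent {zero}  refl = Adj-sym (adjacent i)
        target-adjacent {suc k} e    = edge e

        target-functional : ∀ {k w w′} → target k w → target k w′ → w ≡ w′
        target-functional {zero}  p q = trans p (sym q)
        target-functional {suc k} p q = proper p q

        not-v : ∀ {a} → c u v ≢ just a
        not-v e = contradiction (trans (sym (symm′ e)) (isolated u)) λ ()

        target-injective : ∀ {k l w} → target k w → target l w → k ≡ l
        target-injective {zero}  {zero}  p    q    = refl
        target-injective {zero}  {suc l} refl q    = contradiction q not-v
        target-injective {suc k} {zero}  p    refl = contradiction p not-v
        target-injective {suc k} {suc l} p    q    =
          cong suc (xs-injective (just-injective (trans (sym p) q)))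

        survives : ∀ {w z x y} → c u w ≡ just x → c w z ≡ just y → x ≢ y → erase c u w z ≡ just y
        -- The edge from `w` to `z` cannot lead back to `u`, since the edge between `u` and `w` has
        -- colour `x` instead of `y`; so erasing `u` spares it.
        survives e e′ x≢y = trans (erase-≢ c (λ { refl → Adj-irrefl (edge e) })
          (λ { refl → x≢y (just-injective (trans (sym (symm′ e)) e′)) })) e′

      arranged : ∃ λ us′ → Nbrs u us′ × ∀ {k w} → target k w → us′ k ≡ w
      arranged = arrange (proj₂ (nbrs u)) target target? target-adjacent
        (λ {k} → target-functional {k}) target-injective

      us′ : Fin 4 → V
      us′ = proj₁ arranged

      around′ : Nbrs u us′
      around′ = proj₁ (proj₂ arranged)

      us′-zero : us′ 0F ≡ v
      us′-zero = proj₂ (proj₂ arranged) {0F} refl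

      -- The sets are taken in the erased colouring, before new spokes are drawn, because the
      -- proposal is chosen in dependence on them. `0F` is an arbitrary colour to avoid.
      covering : ∀ k → Cover (erase c u) 0F (us′ (suc k))
      covering k = cover (erase-valid u valid) (Adj-sym (Nbrs.adjacent around′ (suc k)))
        (trans (Valid.symm (erase-valid u valid) (us′ (suc k)) u) (erase-isolated c u (us′ (suc k)))) 0F

      row-of : Fin 3 → Subset
      row-of k = Cover.subset (covering k)

      row-admissible : ∀ {fs} → All Holds fs → ∀ k → row-of k ∈ admissible (needs fs i (xs k))
      row-admissible {fs} hs k = ∈-admissible (Cover.triple (covering k)) λ y∈ →
        let w , z , e , e′ , x≢y = needs-sound fs i (xs k) hs y∈
        in Cover.present (covering k) (trans
             (cong (λ w → erase c u w z) (proj₂ (proj₂ arranged) {suc k} e))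
             (survives e e′ x≢y))

      module _ (st : Vec C 3) (fs : All Free (rim i st)) (as : AllPairs Apart (rim i st))
               (three : size (colourSet st) ≡ 3) where
        open Hop i st fs as

        P′ : Config
        P′ = config (colourSet st) (row-of 0F) (row-of 1F) (row-of 2F)

        threefold′ : Threefold P′
        threefold′ 0F = three
        threefold′ 1F = triple-size (Cover.triple (covering 0F))
        threefold′ 2F = triple-size (Cover.triple (covering 1F))
        threefold′ 3F = triple-size (Cover.triple (covering 2F))

        outer : ∀ k {a y} → hopped (us′ (suc k)) y ≡ just a → T (lookup (row-of k) a)
        outer k e = Cover.present (covering k) (hopped-outer (Nbrs.adjacent around′ (suc k))
          (λ p → contradiction (Nbrs.injective around′ (trans p (sym us′-zero))) λ ()) e)

        position′ : Position u hopped us′ P′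
        position′ = record
          { valid = hopped-valid ; isolated = hopped-isolated ; coloured = hopped-coloured
          ; around = around′ ; covers = covers′ }
          where
          covers′ : ∀ j {a y} → hopped (us′ j) y ≡ just a → T (mem P′ j a)
          covers′ 0F {y = y} e = hopped-centre (trans (cong (λ u → hopped u y) (sym us′-zero)) e)
          covers′ 1F e = outer 0F e
          covers′ 2F e = outer 1F e
          covers′ 3F e = outer 2F e

    rim-∈ : ∀ {i sts} → All (¬_ ∘ Linked) (rimConflicts P i sts) →
            ∀ {st} → st ∈ sts → All (¬_ ∘ Linked) (conflicts P (rim i st))
    rim-∈ {i} {st ∷ sts} ls (here refl) = ++⁻ˡ (conflicts P (rim i st)) ls
    rim-∈ {i} {st ∷ sts} ls (there st∈) = rim-∈ (++⁻ʳ (conflicts P (rim i st)) ls) st∈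

    rim-candidates : ∀ i sts → T (all (proposable P i) sts) → All Candidate (rimConflicts P i sts)
    rim-candidates i []         t = []
    rim-candidates i (st ∷ sts) t with ∧-split {proposable P i st} t
    ... | t , ts = ++⁺ (candidates (rim i st) (proj₁ (∧-split {suitable P (rim i st)} t)))
                       (rim-candidates i sts ts)

    Saturated : Set
    Saturated =
      ∃ λ s → ∀ a b → T (not (mem P 0F a)) → T (mem P 0F b) → Holds (fact 0F (partner s) a b)

    Outcome : Set
    Outcome = Goal ⊎ Saturated

    module _ {bound} (won : Won bound) where

      hop : ∀ {ys} i sts → T (all (proposable P i) sts) →
            T (lowers bound (map colourSet sts) ys i (members P i)) → All Holds ys →
            All (¬_ ∘ Linked) (rimConflicts P i sts) → Goal
      hop {ys} i sts ok low hs ls with lowers-sound {Zs = map colourSet sts} {ys} (members P i) low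
      ... | x , y , z , eq , choose =
        lower (choose (row-admissible hs 0F) (row-admissible hs 1F) (row-admissible hs 2F))
        where
        xs : Fin 3 → C
        xs = lookup (x ∷ y ∷ z ∷ [])
        xs-injective : ∀ {k l} → xs k ≡ xs l → k ≡ l
        xs-injective {k} {l} = distinct₃ (subst Unique eq (members-unique P i)) k l
        open Around i xs xs-injective
        lower : (∃ λ Z → Z ∈ map colourSet sts ×
                   T (level (config Z (row-of 0F) (row-of 1F) (row-of 2F)) <ᵇ bound)) → Goal
        lower (Z , Z∈ , lt) =
          let st , st∈ , Z≡     = ∈-map⁻ colourSet Z∈
              suits , three≡ᵇ   =
                ∧-split {suitable P (rim i st)} (all-∈ (proposable P i) sts ok st∈)
              three = ℕ.≡ᵇ⇒≡ (size (colourSet st)) 3 three≡ᵇ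
              fs = suitable-free (rim i st) suits
              as = apart (rim i st) suits (rim-∈ ls st∈)
          in won (position′ st fs as three) (threefold′ st fs as three)
               (subst (λ Z → T (level (config Z (row-of 0F) (row-of 1F) (row-of 2F)) <ᵇ bound)) Z≡ lt)

      resolve : ∀ {fs} → Outcome ⊎ All (¬_ ∘ Linked) fs → (All (¬_ ∘ Linked) fs → Goal) → Outcome
      resolve (inj₁ o)  _ = o
      resolve (inj₂ ls) g = inj₁ (g ls)

      keep : ∀ {f fs} → ¬ Linked f → Outcome ⊎ All (¬_ ∘ Linked) fs →
        Outcome ⊎ All (¬_ ∘ Linked) (f ∷ fs)
      keep ¬l (inj₁ o)  = inj₁ o
      keep ¬l (inj₂ ls) = inj₂ (¬l ∷ ls)

      sound : ∀ {ys ns} t → T (check bound P ys ns t) → All Holds ys → All (¬_ ∘ Linked) ns →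
        Outcome
      -- Each unrefuted link is decided in the actual colouring by `walk?`. A link that is present
      -- hands over to its subtree; if all are absent, the proposed colouring is legitimate.
      branches : ∀ {ys ns} fs ts → T (branch bound P ys ns fs ts) → All Holds ys →
                 All (¬_ ∘ Linked) ns → All Candidate fs → Outcome ⊎ All (¬_ ∘ Linked) fs

      sound (full p q r s ts) ok hs ¬hs =
        let st = wheel p q r s
            suits , ok′ = ∧-split {suitable P st} ok
        in resolve (branches (conflicts P st) ts ok′ hs ¬hs (candidates st suits))
             λ ls → finish (suitable-free st suits) (apart st suits ls)
      sound {ys} (move i sts ts) ok hs ¬hs =
        let props , ok′ = ∧-split {all (proposable P i) sts} ok
            low , ok″   = ∧-split {lowers bound (map colourSet sts) ys i (members P i)} ok′
        in resolve (branches (rimConflicts P i sts) ts ok″ hs ¬hs (rim-candidates i sts props))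
             (hop i sts props low hs)
      sound {ys} (locked s) ok hs ¬hs = inj₂ (s , holds)
        where
        holds : ∀ a b → T (not (mem P 0F a)) → T (mem P 0F b) → Holds (fact 0F (partner s) a b)
        holds a b ta tb =
          let g , g∈ , p = any-∈ (same (fact 0F (partner s) a b)) ys
                (saturated-sound {P} {ys} ok a b ta tb)
          in subst Holds (sym (same⇒≡ {fact 0F (partner s) a b} {g} p)) (All.lookup hs g∈)

      branches [] ts ok hs ¬hs [] = inj₂ []
      branches {ys} {ns} (f ∷ fs) [] ok hs ¬hs (cf ∷ cs) =
        let r , ok′ = ∧-split {refuted ys ns f} ok
        in keep (refuted-sound {ys} {ns} {f} r hs ¬hs cf) (branches fs [] ok′ hs ¬hs cs)
      branches {ys} {ns} (f ∷ fs) (t ∷ ts) ok hs ¬hs (cf ∷ cs) =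
        [ (λ rok → keep (refuted-sound {ys} {ns} {f} (proj₁ rok) hs ¬hs cf)
                        (branches fs (t ∷ ts) (proj₂ rok) hs ¬hs cs))
        , (λ ok′ → let ok₁ , ok₂ = ∧-split {check bound P (f ∷ ys) ns t} ok′ in
            [ (λ l → inj₁ (sound t ok₁ ((cf , l) ∷ hs) ¬hs))
            , (λ ¬l → keep ¬l (branches fs ts ok₂ hs (¬l ∷ ¬hs) cs))
            ]′ (toSum (walk? valid {x = us (Fact.port₁ f)} (colours≢ cf ∘ sym) (stuck₂ cf))))
        ]′ (if-split {refuted ys ns f} ok)

  relabelled : ∀ {v c us P N} (σ : Permutation′ 4) (π : Permutation′ 6) →
    (∀ i a → T (mem P (σ ⟨$⟩ʳ i) (π ⟨$⟩ʳ a)) → T (mem N i a)) →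
    Position v c us P → Position v (relabel π c) (us ∘ (σ ⟨$⟩ʳ_)) N
  relabelled {c = c} σ π fit pos = record
    { valid    = relabel-valid π c valid
    ; isolated = λ y → cong (Maybe.map (π ⟨$⟩ˡ_)) (isolated y)
    ; coloured = λ w p q → let _ , e = coloured w p q in _ , relabel-just π c e
    ; around   = permuted σ around
    ; covers   = λ i {a} e → fit i a (covers (σ ⟨$⟩ʳ i) (unrelabel π c e)) }
    where open Position pos

  fitted : ∀ {v c us P e} σ π → T (fitting P e σ π) → Position v c us P →
           ∃ λ c′ → ∃ λ us′ → Position v c′ us′ (form e)
  fitted {P = P} {e} σ π t pos =
    let πok , t′ = ∧-split {inverses π (inverse π)} t
        σok , f  = ∧-split {inverses σ (inverse σ)} t′
        N = form e
        fit = λ i a → ⇒ᵇ-elim {mem P (lookup σ i) (lookup π a)} {mem N i a}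
          (all-∈ (λ i → not (mem P (lookup σ i) (lookup π a)) ∨ mem N i a) (allFin 4)
            (all-∈ (λ a → all (λ i → not (mem P (lookup σ i) (lookup π a)) ∨ mem N i a) (allFin 4))
              (allFin 6) f (∈-allFin a)) (∈-allFin i))
    in _ , _ , relabelled (from-inverses σ (inverse σ) σok) (from-inverses π (inverse π) πok) fit pos

  -- Rotating the colours around a neighbour

  module Spin {v c us P R} (pos : Position v c us P) (three : size R ≡ 3)
              (row : ∀ a → mem P 0F a ≡ lookup R a) (sat : At.Saturated pos) where
    open Position pos
    open Valid valid
    open Nbrs around using (injective; adjacent)

    private
      y : V
      y = us 0F
      d : Partial
      d = erase c y
      s : V → Maybe C
      s w = Maybe.map (rotate R) (c y w)

    in-row : ∀ {w b} → c y w ≡ just b → T (lookup R b)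
    in-row {b = b} e = subst T (row b) (covers 0F e)

    private
      survives : ∀ {w w′ z a b} → c y w ≡ just b → c y w′ ≡ just b → c w′ z ≡ just a → b ≢ a →
                 d w z ≡ just a
      survives e e′ f b≢a with refl ← proper e e′ =
        trans (erase-≢ c (λ { refl → Adj-irrefl (edge e) })
        (λ { refl → b≢a (just-injective (trans (sym (symm′ e)) f)) })) f

      -- For every colour outside `R` some link leaves `y` along `b` to `w` and goes on in that
      -- colour. So the three other edges at `w` carry exactly the complement of `R`, and all of `R`
      -- is free at `w` once `y` is erased. Hence any permutation of the colours at `y` stays
      -- proper, and no link can even start.
      clean : ∀ {w b a} → c y w ≡ just b → T (lookup R a) → Stuck d a w
      clean {w} {b} {a} e a∈ z e′ =
        complement R three (Cover.subset cov) (triple-size (Cover.triple cov)) both a a∈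
          (Cover.present cov e′)
        where
        cov : Cover d 0F w
        cov = cover (erase-valid y valid) (Adj-sym (edge e))
          (trans (Valid.symm (erase-valid y valid) w y) (erase-isolated c y w)) 0F
        both : ∀ a → T (lookup R a ∨ lookup (Cover.subset cov) a)
        both a = ∨-default (lookup R a) λ eq →
          let cand , _ , walk = proj₂ sat a b (subst (T ∘ not) (sym (trans (row a) eq)) _)
                                  (subst T (sym (row b)) (in-row e))
              open At.Candidate cand
              _ , _ , e₁ , e₂ = departs² walk (colours≢ ∘ sym) (ports≢ ∘ injective)
          in Cover.present cov (survives e e₁ e₂ (colours≢ ∘ sym))

      s-just : ∀ {w a} → s w ≡ just a → ∃ λ b → c y w ≡ just b × rotate R b ≡ a
      s-just {w} e with c y w
      s-just refl | just b = b , refl , refl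

      s-row : ∀ {w a} → s w ≡ just a → T (lookup R a)
      s-row e = let _ , f , p = s-just e in subst (T ∘ lookup R) p (rotate-∈ R three (in-row f))

      rainbow : ∀ {w z a} → s w ≡ just a → s z ≡ just a → w ≡ z
      rainbow e e′ =
        let _ , f , p = s-just e ; b′ , f′ , p′ = s-just e′
            b≡b′ = rotate-injective R three (in-row f) (in-row f′) (trans p (sym p′))
        in proper (trans f (cong just b≡b′)) f′

      free : ∀ {w a} → s w ≡ just a → Stuck d a w
      free e = clean (proj₁ (proj₂ (s-just e))) (s-row e)

      unlinked : ∀ {p q a b} → s p ≡ just a → s q ≡ just b → p ≢ q → ∀ {k} → ¬ Walk d k b a p b a q
      unlinked e e′ p≢q w =
        let z , g = departs w p≢q in clean (proj₁ (proj₂ (s-just e))) (s-row e′) z g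

      star : Star d y s
      star = record
        { adjacent = λ e → edge (proj₁ (proj₂ (s-just e)))
        ; rainbow = rainbow ; free = free ; unlinked = unlinked }

    spun : Partial
    spun = extend d y s

    spun-off : ∀ {x z} → x ≢ y → z ≢ y → spun x z ≡ c x z
    spun-off x≢y z≢y = trans (extend-≢ d s x≢y z≢y) (erase-≢ c x≢y z≢y)

    spun-on : ∀ w → spun y w ≡ Maybe.map (rotate R) (c y w)
    spun-on w = extend-ˡ d y s w

    private
      y≢v : y ≢ v
      y≢v e = Adj-irrefl (subst (Adj G v) e (adjacent 0F))

      spoke : ∀ {w} → (∃ λ a → c y w ≡ just a) → ∃ λ a → s w ≡ just a
      spoke (_ , e) = _ , cong (Maybe.map (rotate R)) e

    spun-position : Position v spun us P
    spun-position = record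
      { valid    = extend-valid (erase-valid y valid) (erase-isolated c y) star
      ; isolated = λ z → case z ≟ y of λ where
          (yes z≡y) → subst (λ z → spun v z ≡ nothing) (sym z≡y) (trans (extend-ʳ d y s v)
                        (cong (Maybe.map (rotate R)) (trans (symm y v) (isolated y))))
          (no z≢y)  → trans (spun-off (y≢v ∘ sym) z≢y) (isolated z)
      ; coloured = col′ ; around = around ; covers = cov′ }
      where
      col′ : ∀ {x z} → Wanted x z → x ≢ v → z ≢ v → ∃ λ a → spun x z ≡ just a
      col′ {x} {z} w x≢v z≢v = case x ≟ y of λ where
        (yes x≡y) → subst (λ x → ∃ λ a → spun x z ≡ just a) (sym x≡y)
          (let a , e = spoke (subst (λ x → ∃ λ a → c x z ≡ just a) x≡y (coloured w x≢v z≢v))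
           in a , trans (extend-ˡ d y s z) e)
        (no x≢y) → case z ≟ y of λ where
          (yes z≡y) → subst (λ z → ∃ λ a → spun x z ≡ just a) (sym z≡y)
            (let b , f = subst (λ z → ∃ λ a → c x z ≡ just a) z≡y (coloured w x≢v z≢v)
                 a , e = spoke (b , symm′ f) in a , trans (extend-ʳ d y s x) e)
          (no z≢y) → let a , e = coloured w x≢v z≢v in a , trans (spun-off x≢y z≢y) e

      -- Two neighbours of `v` are not adjacent, so the rotation touches no edge at `us i`.
      off-centre : ∀ i → us i ≢ y → ∀ {a z} → spun (us i) z ≡ just a → T (mem P i a)
      off-centre i ui≢y {a} {z} e = case z ≟ y of λ where
        (yes z≡y) →
          let _ , f , _ = s-just (trans (sym (extend-ʳ d y s (us i)))
                            (subst (λ z → spun (us i) z ≡ just a) z≡y e))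
          in ⊥-elim (triangleFree v y (us i) (adjacent 0F , edge f , Adj-sym (adjacent i)))
        (no z≢y)  → covers i (trans (sym (spun-off ui≢y z≢y)) e)

      cov′ : ∀ i {a z} → spun (us i) z ≡ just a → T (mem P i a)
      cov′ 0F {a} {z} e =
        let b , f , p = s-just (trans (sym (extend-ˡ d y s z)) e)
        in subst T (sym (row a)) (subst (T ∘ lookup R) p (rotate-∈ R three (in-row f)))
      cov′ (suc i) = off-centre (suc i) (λ p → contradiction (injective p) λ ())

  -- Read backwards, the links towards a common partner start at that partner in both colourings
  -- with the same colours and end at `us 0F`, which `no-meeting` forbids. One pair of colours is
  -- enough for the contradiction.
  unsaturated : ∀ {v c c′ us P R} (pos : Position v c us P) (pos′ : Position v c′ us P) →
    size R ≡ 3 →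
    (∀ a → mem P 0F a ≡ lookup R a) →
    (∀ {x z} → x ≢ us 0F → z ≢ us 0F → c′ x z ≡ c x z) →
    (∀ {w a} → c (us 0F) w ≡ just a → c′ (us 0F) w ≢ just a) →
    (sat : At.Saturated pos) (sat′ : At.Saturated pos′) → proj₁ sat ≢ proj₁ sat′
  unsaturated {us = us} {R = R} pos pos′ three row off on (s , hold) (.s , hold′) refl =
    let a , a∉ = absentee R three
        b , b∈ = member R three
        ta = subst (T ∘ not) (sym (row a)) a∉
        tb = subst T (sym (row b)) b∈
        cand , _ , w = hold a b ta tb
        _ , _ , w′ = hold′ a b ta tb
    in no-meeting (Position.valid pos) (Position.valid pos′) off on
         (At.Candidate.ports≢ cand ∘ sym ∘ Nbrs.injective (Position.around pos))
         (reverse (Position.valid pos) w) (reverse (Position.valid pos′) w′)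

  two-of-three : ∀ {x y z : Bool} → x ≢ y → y ≢ z → x ≢ z → ⊥
  two-of-three {true}  {true}          p q r = p refl
  two-of-three {false} {false}         p q r = p refl
  two-of-three {true}  {false} {true}  p q r = r refl
  two-of-three {true}  {false} {false} p q r = q refl
  two-of-three {false} {true}  {true}  p q r = q refl
  two-of-three {false} {true}  {false} p q r = r refl

  -- Of the three rotations of the colours around neighbour 0, no two are saturated towards
  -- the same neighbour, and there are only two candidates.
  module _ {v : V} {us : Fin 4 → V} {P : Config} (R : Subset) (three : size R ≡ 3)
           (row : ∀ a → mem P 0F a ≡ lookup R a) where

    private
      y : V
      y = us 0F

      Off : Partial → Partial → Set
      Off c c′ = ∀ {x z} → x ≢ y → z ≢ y → c′ x z ≡ c x z

      On : (C → C) → Partial → Partial → Set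
      On ρ c c′ = ∀ w → c′ y w ≡ Maybe.map ρ (c y w)

      differs : ∀ ρ c c′ {w a} → On ρ c c′ → ρ a ≢ a → c y w ≡ just a → c′ y w ≢ just a
      differs ρ c c′ {w} on ρa≢a e e′ =
        ρa≢a (just-injective (trans (sym (trans (on w) (cong (Maybe.map ρ) e))) e′))

      row-∈ : ∀ {c} → Position v c us P → ∀ {w a} → c y w ≡ just a → T (lookup R a)
      row-∈ pos {a = a} e = subst T (row a) (Position.covers pos 0F e)

      spin : ∀ {c} (pos : Position v c us P) → At.Saturated pos →
             ∃ λ c′ → Position v c′ us P × Off c c′ × On (rotate R) c c′
      spin pos sat = spun , spun-position , spun-off , spun-on
        where open Spin {R = R} pos three row sat

      compose : ∀ ρ c c′ c″ → On ρ c c′ → On ρ c′ c″ → On (ρ ∘ ρ) c c″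
      compose ρ c c′ c″ on on′ w = trans (on′ w) (trans (cong (Maybe.map ρ) (on w)) (twice (c y w)))
        where
        twice : ∀ m → Maybe.map ρ (Maybe.map ρ m) ≡ Maybe.map (ρ ∘ ρ) m
        twice (just _) = refl
        twice nothing  = refl

      third : ∀ {c₀ c₁ c₂} (p₀ : Position v c₀ us P) (p₁ : Position v c₁ us P)
        (p₂ : Position v c₂ us P) →
        Off c₀ c₁ → On (rotate R) c₀ c₁ → Off c₁ c₂ → On (rotate R) c₁ c₂ →
        At.Saturated p₀ → At.Saturated p₁ → ¬ At.Saturated p₂
      third {c₀} {c₁} {c₂} p₀ p₁ p₂ off on off′ on′ s₀ s₁ s₂ = two-of-three
        (unsaturated {R = R} p₀ p₁ three row off
          (λ e → differs ρ c₀ c₁ on (rotate-≢ R three (row-∈ p₀ e)) e) s₀ s₁)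
        (unsaturated {R = R} p₁ p₂ three row off′
          (λ e → differs ρ c₁ c₂ on′ (rotate-≢ R three (row-∈ p₁ e)) e) s₁ s₂)
        (unsaturated {R = R} p₀ p₂ three row (λ p q → trans (off′ p q) (off p q))
          (λ e → differs (ρ ∘ ρ) c₀ c₂ (compose ρ c₀ c₁ c₂ on on′)
            (rotate²-≢ R three (row-∈ p₀ e)) e) s₀ s₂)
        where
        ρ : C → C
        ρ = rotate R

    by-rotation : ∀ {c} → (∀ {c} (pos : Position v c us P) → At.Outcome pos) →
      Position v c us P → Goal
    by-rotation run p₀ with run p₀
    ... | inj₁ g  = g
    ... | inj₂ s₀ with spin p₀ s₀
    ... | _ , p₁ , off , on with run p₁
    ... | inj₁ g  = g
    ... | inj₂ s₁ with spin p₁ s₁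
    ... | _ , p₂ , off′ , on′ with run p₂
    ... | inj₁ g  = g
    ... | inj₂ s₂ = ⊥-elim (third p₀ p₁ p₂ off on off′ on′ s₀ s₁ s₂)

  -- Induction on the level

  record Sound (e : Entry) : Set where
    field
      checks : T (check (level (form e)) (form e) [] [] (tree e))
      low    : level (form e) ≤ 4
      even   : Threefold (form e)

  entry-sound : ∀ {e} → e ∈ table → Sound e
  entry-sound {e} e∈ =
    let t , t′ = ∧-split {check (level (form e)) (form e) [] [] (tree e)}
                   (all-∈ checked table (≡true⇒T table-checked) e∈)
        l , h  = ∧-split {level (form e) ≤ᵇ 4} t′
    in record { checks = t ; low = ℕ.≤ᵇ⇒≤ (level (form e)) 4 l ; even = T⇒threefold {form e} h }

  entry-goal : ∀ {e v c us} → e ∈ table → Won (level (form e)) → Position v c us (form e) → Goal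
  entry-goal {e} e∈ won = by-rotation (row₀ e) (even 0F) (λ _ → refl)
    (λ pos → At.sound pos won (tree e) checks [] [])
    where open Sound (entry-sound e∈)

  signed-∈ : ∀ {s e} → (s , e) ∈ signed → e ∈ table
  signed-∈ p with ∈-map⁻ (λ e → signature (form e) , e) {xs = table} p
  ... | _ , e∈ , refl = e∈

  module _ {v c us P} (pos : Position v c us P) (three : Threefold P) where

    private
      shuffled : ∃ λ (π : Permutation′ 6) → Sorted (columns 4) (tabulate (P ∘ (π ⟨$⟩ʳ_)))
      shuffled = sort (Vec.≡-dec Bool._≟_) 6 P (columns 4) (λ a → ∈-columns (P a))

      π : Permutation′ 6
      π = proj₁ shuffled

      P′ : Config
      P′ = lookup (tabulate (P ∘ (π ⟨$⟩ʳ_)))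

      P′≡ : ∀ i a → mem P′ i a ≡ mem P i (π ⟨$⟩ʳ a)
      P′≡ i a = cong (λ v → lookup v i) (lookup∘tabulate (P ∘ (π ⟨$⟩ʳ_)) a)

      level≡ : level P′ ≡ level P
      level≡ = cong grade (count-permute weight P π)

      pos′ : Position v (relabel π c) us P′
      pos′ = relabelled Perm.id π (λ i a → subst T (sym (P′≡ i a))) pos

      uniform′ : Uniform P′ → Uniform P
      uniform′ u i a = trans (back i) (trans (u i (π ⟨$⟩ˡ a)) (sym (back 0F)))
        where
        back : ∀ i → mem P i a ≡ mem P′ i (π ⟨$⟩ˡ a)
        back i = sym (trans (P′≡ i (π ⟨$⟩ˡ a)) (cong (mem P i) (inverseʳ π)))

    dispatch : (∀ {e} → e ∈ table → level (form e) ≤ level P → Won (level (form e))) →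
               Goal ⊎ (Uniform P × level P ≡ 5)
    dispatch won = go (classify (sorted-sound (columns 4) (λ cols → classified signed (lookup cols))
                                  (≡true⇒T table-complete) (proj₂ shuffled)))
      where
      go : Classified signed P′ → Goal ⊎ (Uniform P × level P ≡ 5)
      go (uneven t) = contradiction
        (threefold⇒T {P′} (λ i → trans (count-permute (λ v → if lookup v i then 1 else 0) P π) (three i)))
        (T-not t)
      go (rigid u l) = inj₂ (uniform′ (uniform-sound {P′} u) , trans (sym level≡) l)
      go (matches {e = e} p l σ ρ f) =
        let e∈ = signed-∈ p
            _ , _ , q = fitted {e = e} σ ρ f pos′
        in inj₁ (entry-goal e∈ (won e∈ (subst (level (form e) ≤_) level≡ (ℕ.≤ᵇ⇒≤ _ _ l))) q)

  -- The bound stops at 5 to keep out four equal sets: below it, the second outcome of `dispatch`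
  -- contradicts its own level.
  won : ∀ b → b ≤ 5 → Won b
  won (suc b) b<5 {P = P} pos three lt =
    let P≤b = ℕ.≤-pred (ℕ.<ᵇ⇒< (level P) (suc b) lt) in
    [ id , (λ (_ , l) → ⊥-elim (ℕ.<⇒≱ b<5 (subst (_≤ b) l P≤b))) ]′
      (dispatch pos three (λ {e} _ l pos′ three′ lt′ → won b (ℕ.<⇒≤ b<5) pos′ three′
        (ℕ.<⇒<ᵇ (ℕ.<-≤-trans (ℕ.<ᵇ⇒< _ (level (form e)) lt′) (ℕ.≤-trans l P≤b)))))

  settle : ∀ {v c us P} → Position v c us P → Threefold P → Goal ⊎ Uniform P
  settle pos three = [ inj₁ , inj₂ ∘ proj₁ ]′ (dispatch pos three λ {e} e∈ _ pos′ three′ lt →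
    won 5 ℕ.≤-refl pos′ three′ (ℕ.<⇒<ᵇ (ℕ.<-≤-trans (ℕ.<ᵇ⇒< _ (level (form e)) lt)
      (ℕ.m≤n⇒m≤1+n (Sound.low (entry-sound e∈))))))

  -- The number k of steps of the walk decreases when neighbour 0 becomes the missing vertex.
  record Rigid (k : ℕ) (x z : C) : Set where
    field
      {v}     : V
      {c}     : Partial
      {us}    : Fin 4 → V
      {P}     : Config
      pos     : Position v c us P
      three   : Threefold P
      uni     : Uniform P
      x∈      : T (mem P 0F x)
      z∉      : T (not (mem P 0F z))
      {a b}   : C
      {e}     : V
      walk    : Walk c k x z (us 0F) a b e
      stuck   : Stuck c a e

  -- Four equal sets: pushing the missing vertex

  module Padded {v c us} (valid : Valid c) (isolated : Isolated c v) (around : Nbrs {4} v us)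
                (coloured : ∀ {x y} → Wanted x y → x ≢ v → y ≢ v → ∃ λ a →
                  c x y ≡ just a) (x : C) where
    open Nbrs around

    padding : ∀ i → Cover c x (us i)
    padding i =
      cover valid (Adj-sym (adjacent i)) (trans (Valid.symm valid (us i) v) (isolated (us i))) x

    padded : Config
    padded = config (Cover.subset (padding 0F)) (Cover.subset (padding 1F))
                    (Cover.subset (padding 2F)) (Cover.subset (padding 3F))

    padded-mem : ∀ i a → mem padded i a ≡ lookup (Cover.subset (padding i)) a
    padded-mem 0F a = refl
    padded-mem 1F a = refl
    padded-mem 2F a = refl
    padded-mem 3F a = refl

    padded-threefold : Threefold padded
    padded-threefold 0F = triple-size (Cover.triple (padding 0F))
    padded-threefold 1F = triple-size (Cover.triple (padding 1F))
    padded-threefold 2F = triple-size (Cover.triple (padding 2F))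
    padded-threefold 3F = triple-size (Cover.triple (padding 3F))

    padded-position : Position v c us padded
    padded-position = record
      { valid = valid ; isolated = isolated ; coloured = coloured ; around = around
      ; covers = λ i {a} e → subst T (sym (padded-mem i a)) (Cover.present (padding i) e) }

  -- A walk of length 0 means that `x` does not occur at neighbour 0. Its set can be replaced by one
  -- without `x`, while the other three still contain `x`; the sets are then no longer all equal,
  -- and the table applies.
  stop : ∀ {x z} → Rigid 0 x z → Goal
  stop {x} record { us = us ; P = P ; pos = pos ; three = three ; uni = uni ; x∈ = x∈
                  ; walk = [] ; stuck = stuck } =
    [ id , (λ uni′ → contradiction
        (subst T (trans (sym (trans (rowOf-lookup P 1F x) (uni 1F x))) (uni′ 1F x)) x∈)
        (Cover.absent (padding 0F) stuck)) ]′ (settle pos′ three′)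
    where
    open Position pos
    open Padded valid isolated around coloured x
    P′ : Config
    P′ = config (Cover.subset (padding 0F)) (rowOf P 1F) (rowOf P 2F) (rowOf P 3F)
    three′ : Threefold P′
    three′ 0F = triple-size (Cover.triple (padding 0F))
    three′ 1F = rowOf-size {P} three 1F
    three′ 2F = rowOf-size {P} three 2F
    three′ 3F = rowOf-size {P} three 3F
    covers′ : ∀ i {a y} → _ ≡ just a → T (mem P′ i a)
    covers′ 0F e = Cover.present (padding 0F) e
    covers′ 1F {a} e = subst T (sym (rowOf-lookup P 1F a)) (covers 1F e)
    covers′ 2F {a} e = subst T (sym (rowOf-lookup P 2F a)) (covers 2F e)
    covers′ 3F {a} e = subst T (sym (rowOf-lookup P 3F a)) (covers 3F e)
    pos′ : Position _ _ us P′
    pos′ = record { valid = valid ; isolated = isolated ; coloured = coloured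
                  ; around = around ; covers = covers′ }

  -- A colour outside the common set is absent at every neighbour, so no link obstructs the move to
  -- neighbour 0. Afterwards `v` carries `z`, and `w` has lost its edge coloured `x`. If the new
  -- sets are equal again, they contain `z` and miss `x`: the two colours change roles and the walk
  -- has lost its first edge.
  module Shift {k x z} (rig : Rigid (suc k) x z) {w : V}
               (first : Rigid.c rig (Rigid.us rig 0F) w ≡ just x)
               (rest : Walk (Rigid.c rig) k z x w (Rigid.a rig) (Rigid.b rig) (Rigid.e rig))
               (p q r : C) where
    open Rigid rig
    open Position pos
    open Valid valid
    open Nbrs around
    open At pos using (Free; Apart; Linked)

    private
      y : V
      y = us 0F
      st : Vec C 3
      st = p ∷ q ∷ r ∷ []

    module _ (p∉ : T (not (mem P 0F p))) (q∉ : T (not (mem P 0F q))) (r∉ : T (not (mem P 0F r)))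
             (p≢q : p ≢ q) (p≢r : p ≢ r) (q≢r : q ≢ r)
             (z∈st : ∃ λ j → (j , z) ∈ rim 0F st) (avoid : ∀ {j} → (j , z) ∈ rim 0F st →
               us j ≢ e) where

      private
        outside : ∀ {a} → T (not (mem P 0F a)) → ∀ i → Stuck c a (us i)
        outside {a} a∉ i t f = T-not a∉ (subst T (uni i a) (covers i f))

        apart : ∀ {i j a b} → i ≢ j → a ≢ b → T (not (mem P 0F b)) → Apart (i , a) (j , b)
        apart i≢j a≢b b∉ = i≢j , a≢b , λ (_ , w) →
          let _ , f = departs w (i≢j ∘ injective) in outside b∉ _ _ f

        fs : All Free (rim 0F st)
        fs = outside p∉ 1F ∷ outside q∉ 2F ∷ outside r∉ 3F ∷ []

        as : AllPairs Apart (rim 0F st)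
        as = (apart (λ ()) p≢q q∉ ∷ apart (λ ()) p≢r r∉ ∷ []) ∷ (apart (λ ()) q≢r r∉ ∷ []) ∷ [] ∷ []

        st∉ : ∀ {j a} → (j , a) ∈ rim 0F st → T (not (mem P 0F a))
        st∉ (here refl)                 = p∉
        st∉ (there (here refl))         = q∉
        st∉ (there (there (here refl))) = r∉

      open At.Hop pos 0F st fs as

      private
        z≢x : z ≢ x
        z≢x refl = T-not z∉ x∈

        v-isolated : ∀ {u a} → c u v ≢ just a
        v-isolated {u} f = contradiction (trans (sym (symm′ f)) (isolated u)) λ ()

        w≢v : w ≢ v
        w≢v refl = v-isolated first

        w≢y : w ≢ y
        w≢y refl = Adj-irrefl (edge first)

        -- The walk from `w` survives because it never meets `y` again: no edge at `y` is coloured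
        -- `z`, and arriving along `x` would mean a return to `w`.
        travel : ∀ {m l g h u a b t} → Walk c m z x w g h u → u ≢ y → Walk c l g h u a b t →
                 Walk hopped l g h u a b t
        travel before u≢y [] = []
        travel {g = g} {u = u} before u≢y (_∷_ {y = u′} f after) =
          trans (extend-≢ (erase c y) _ u≢v u′≢v) (trans (erase-≢ c u≢y u′≢y) f)
          ∷ travel (before ▷ f) u′≢y after
          where
          u≢v : u ≢ v
          u≢v refl = contradiction (trans (sym f) (isolated u′)) λ ()
          u′≢v : u′ ≢ v
          u′≢v refl = v-isolated f
          u′≢y : u′ ≢ y
          u′≢y refl with colours before
          ... | inj₁ (refl , refl) = T-not z∉ (covers 0F (symm′ f))
          ... | inj₂ (refl , refl) with refl ← proper (symm′ f) first = no-return valid z≢x before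

        -- Only a new spoke could prolong the walk at its end. Its colour would be `z`, which
        -- `avoid` rules out, or `x`, which no spoke has.
        stuck′ : Stuck hopped a e
        stuck′ t f = case t ≟ v of λ where
          (yes t≡v) →
            let j , j∈ , us≡ = spokes-just us (rim 0F st)
                  (trans (sym (extend-ʳ (erase c y) v _ e)) (subst (λ t → hopped e t ≡ just a) t≡v f))
            in [ (λ (a≡z , _) → avoid (subst (λ a → (j , a) ∈ rim 0F st) a≡z j∈) us≡)
               , (λ (a≡x , _) → T-not (st∉ (subst (λ a → (j , a) ∈ rim 0F st) a≡x j∈)) x∈)
               ]′ (colours rest)
          (no t≢v) → stuck t (erase⊆ c y {e} {t}
            (trans (sym (extend-≢ (erase c y) _ (avoids valid isolated w≢v rest) t≢v)) f))

        target : Fin 4 → V → Set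
        target k u = k ≡ 0F × u ≡ w

        target? : ∀ k → Dec (∃ (target k))
        target? zero    = yes (w , refl , refl)
        target? (suc k) = no λ ()

        arranged : ∃ λ (us′ : Fin 4 → V) → Nbrs y us′ × ∀ {k u} → target k u → us′ k ≡ u
        arranged = arrange (proj₂ (nbrs y)) target target? (λ { (_ , refl) → edge first })
          (λ { (_ , refl) (_ , refl) → refl }) (λ { (refl , _) (refl , _) → refl })

        us′ : Fin 4 → V
        us′ = proj₁ arranged

        around′ : Nbrs y us′
        around′ = proj₁ (proj₂ arranged)

        us′-zero : us′ 0F ≡ w
        us′-zero = proj₂ (proj₂ arranged) (refl , refl)

      open Padded hopped-valid hopped-isolated around′ hopped-coloured x

      private
        spoke : ∀ {j g} → (j , g) ∈ rim 0F st → ∃ λ t → hopped v t ≡ just g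
        spoke {j} j∈ with spokes-cover us (rim 0F st) j∈
        ... | g , f with spokes-just us (rim 0F st) f
        ... | i , i∈ , us≡ with refl ← injective us≡ with pair-∈ as i∈ j∈
        ... | inj₁ refl = us j , trans (extend-ˡ (erase c y) v _ (us j)) f
        ... | inj₂ (inj₁ (j≢j , _)) = contradiction refl j≢j
        ... | inj₂ (inj₂ (j≢j , _)) = contradiction refl j≢j

        spoke-z : ∃ λ t → hopped v t ≡ just z
        spoke-z = spoke (proj₂ z∈st)

        z∈′ : Uniform padded → T (mem padded 0F z)
        z∈′ uni′ with Nbrs.onto around′ (Adj-sym (adjacent 0F))
        ... | j , us≡ = subst T (uni′ j z) (Position.covers padded-position j
          (trans (cong (λ u → hopped u (proj₁ spoke-z)) us≡) (proj₂ spoke-z)))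

        x∉w : Stuck hopped x w
        x∉w t f =
          let f′ = hopped-outer (edge first) w≢v f
              t≡y = proper (erase⊆ c y {w} {t} f′) (symm′ first)
          in contradiction (trans (sym (subst (λ t → erase c y w t ≡ just x) t≡y f′))
               (trans (Valid.symm (erase-valid y valid) w y) (erase-isolated c y w))) λ ()

        x∉′ : T (not (mem padded 0F x))
        x∉′ = not-T (Cover.absent (padding 0F) (subst (Stuck hopped x) (sym us′-zero) x∉w))

        walk′ : Walk hopped k z x (us′ 0F) a b e
        walk′ = subst (λ u → Walk hopped k z x u a b e) (sym us′-zero) (travel [] w≢y rest)

      shift : Goal ⊎ Rigid k z x
      shift = [ inj₁ , (λ uni′ → inj₂ (record
        { pos = padded-position ; three = padded-threefold ; uni = uni′ ; x∈ = z∈′ uni′ ; z∉ = x∉′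
        ; walk = walk′ ; stuck = stuck′ })) ]′ (settle padded-position padded-threefold)

  advance : ∀ {k x z} → Rigid (suc k) x z → Goal ⊎ Rigid k z x
  advance {k} {x} {z} rig@record { us = us ; P = P ; pos = pos ; three = three ; z∉ = z∉
                                 ; e = e ; walk = first ∷ rest } =
    let z′ , z″ , z′∉ , z″∉ , z≢z′ , z≢z″ , z′≢z″ =
          others (rowOf P 0F) (rowOf-size {P} three 0F) (subst (T ∘ not) (sym (rowOf-lookup P 0F z)) z∉)
    -- The spoke coloured `z` must not hit the end `e` of the walk. At most one of neighbours 1 and
    -- 2 is `e`, so one of them can take `z`.
    in choose z′ z″ (out z′∉) (out z″∉) z≢z′ z≢z″ z′≢z″ (us 1F ≟ e)
    where
    open Nbrs (Position.around pos)

    out : ∀ {a} → T (not (lookup (rowOf P 0F) a)) → T (not (mem P 0F a))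
    out {a} = subst (T ∘ not) (rowOf-lookup P 0F a)

    choose : ∀ z′ z″ → T (not (mem P 0F z′)) → T (not (mem P 0F z″)) → z ≢ z′ → z ≢ z″ → z′ ≢ z″ →
             Dec (us 1F ≡ e) → Goal ⊎ Rigid k z x
    choose z′ z″ z′∉ z″∉ z≢z′ z≢z″ z′≢z″ (yes us₁≡e) =
      Shift.shift rig first rest z′ z z″ z′∉ z∉ z″∉ (z≢z′ ∘ sym) z′≢z″ z≢z″
        (2F , there (here refl)) avoid
      where
      avoid : ∀ {j} → (j , z) ∈ rim 0F (z′ ∷ z ∷ z″ ∷ []) → us j ≢ e
      avoid (here refl)                 _    = z≢z′ refl
      avoid (there (here refl))         us≡e =
        contradiction (injective (trans us≡e (sym us₁≡e))) λ ()
      avoid (there (there (here refl))) _    = z≢z″ refl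
    choose z′ z″ z′∉ z″∉ z≢z′ z≢z″ z′≢z″ (no us₁≢e) =
      Shift.shift rig first rest z z′ z″ z∉ z′∉ z″∉ z≢z′ z≢z″ z′≢z″ (1F , here refl) avoid
      where
      avoid : ∀ {j} → (j , z) ∈ rim 0F (z ∷ z′ ∷ z″ ∷ []) → us j ≢ e
      avoid (here refl)                 = us₁≢e
      avoid (there (here refl))         = contradiction refl z≢z′
      avoid (there (there (here refl))) = contradiction refl z≢z″

  rigid-goal : ∀ k {x z} → Rigid k x z → Goal
  rigid-goal zero    rig = stop rig
  rigid-goal (suc k) rig = [ id , rigid-goal k ]′ (advance rig)

  solve : ∀ {v c us P} → Position v c us P → Threefold P → Goal
  solve {us = us} {P} pos three = [ id , start ]′ (settle pos three)
    where
    R : Subset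
    R = rowOf P 0F
    start : Uniform P → Goal
    start uni =
      let x , x∈R = member R (rowOf-size {P} three 0F)
          z , z∉R = absentee R (rowOf-size {P} three 0F)
          x∈ = subst T (rowOf-lookup P 0F x) x∈R
          z∉ = subst (T ∘ not) (rowOf-lookup P 0F z) z∉R
          open Halts (Valid.halts (Position.valid pos) {x} {z}
            (λ x≡z → T-not z∉ (subst (T ∘ mem P 0F) x≡z x∈)) (us 0F))
      in rigid-goal len (record { pos = pos ; three = three ; uni = uni ; x∈ = x∈ ; z∉ = z∉
                                ; walk = walk ; stuck = stuck })

-- Total colourings

module Assembly {n : ℕ} (G : Graph n) (regular : Regular 4 G) (triangleFree : TriangleFree G) where
  open Walks G
  open Positions G regular

  Within : ℕ → V → V → Set
  Within k x y = Adj G x y × toℕ x < k × toℕ y < k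

  Coloured : ℕ → Set
  Coloured k = ∃ λ c → Valid c × (∀ {x y} → Within k x y → ∃ λ a → c x y ≡ just a)

  add-vertex : ∀ {k} → k < n → Coloured k → Coloured (suc k)
  add-vertex {k} k<n (c , ok , col) = solve padded-position padded-threefold
    where
    open Game G regular triangleFree (Within (suc k)) proj₁
    v : V
    v = fromℕ< k<n
    below : ∀ {x} → toℕ x < suc k → x ≢ v → toℕ x < k
    below {x} x<1+k x≢v = ℕ.≤∧≢⇒< (ℕ.≤-pred x<1+k)
      (λ e → x≢v (toℕ-injective (trans e (sym (toℕ-fromℕ< k<n)))))
    coloured : ∀ {x y} → Within (suc k) x y → x ≢ v → y ≢ v → ∃ λ a → erase c v x y ≡ just a
    coloured (e , x< , y<) x≢v y≢v =
      let a , f = col (e , below x< x≢v , below y< y≢v) in a , trans (erase-≢ c x≢v y≢v) f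
    -- The given colouring may already colour edges at `v`, since `finish` colours all four edges at
    -- a vertex, including those to vertices not yet added. They are erased to make `v` isolated.
    open Padded (erase-valid v ok) (erase-isolated c v) (proj₂ (nbrs v)) coloured 0F

  build : ∀ k → k ≤ n → Coloured k
  build zero    _   = (λ _ _ → nothing) , record
    { symm = λ _ _ → refl ; edge = λ () ; proper = λ ()
    ; halts = λ _ _ → halting [] λ _ () } , λ { (_ , () , _) }
  build (suc k) k<n = add-vertex k<n (build k (ℕ.<⇒≤ k<n))

-- From halting walks to acyclic colourings

last-or-inject₁ : ∀ {k} (i : Fin (suc k)) → i ≡ fromℕ k ⊎ ∃ λ j → i ≡ inject₁ j
last-or-inject₁ {zero}  zero    = inj₁ refl
last-or-inject₁ {suc k} zero    = inj₂ (zero , refl)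
last-or-inject₁ {suc k} (suc i) with last-or-inject₁ i
... | inj₁ e       = inj₁ (cong suc e)
... | inj₂ (j , e) = inj₂ (suc j , cong suc e)

module Conversion {n : ℕ} (G : Graph n) {c : Walks.Partial G} (valid : Walks.Valid G c)
                  (total : ∀ {x y} → Adj G x y → ∃ λ a → c x y ≡ just a) where
  open Walks G
  open Valid valid

  colouring : EdgeColouring G 6
  colouring = record
    { col    = λ x y → Maybe.fromMaybe 0F (c x y)
    ; colSym = λ x y → cong (Maybe.fromMaybe 0F) (symm x y) }

  col-just : ∀ {x y} → Adj G x y → c x y ≡ just (col colouring x y)
  col-just {x} {y} e with c x y | total e
  ... | just _ | _ = refl

  is-proper : Proper colouring
  is-proper u v w e e′ v≢w eq =
    v≢w (proper (trans (col-just e) (cong just eq)) (col-just e′))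

  module _ {m} (cyc : Cycle G m) {a b} (bi : IsBichromatic colouring cyc a b) where

    private
      f : Fin (suc (suc (suc m))) → V
      f = vert cyc

      Near : Fin (suc (suc (suc m))) → Fin (suc (suc (suc m))) → Set
      Near i j = c (f i) (f j) ≡ just a ⊎ c (f i) (f j) ≡ just b

      near : ∀ {i j} → Adj G (f i) (f j) →
             (let x = col colouring (f i) (f j) in x ≡ a ⊎ x ≡ b) → Near i j
      near e (inj₁ p) = inj₁ (trans (col-just e) (cong just p))
      near e (inj₂ p) = inj₂ (trans (col-just e) (cong just p))

      near-sym : ∀ {i j} → Near i j → Near j i
      near-sym (inj₁ e) = inj₁ (symm′ e)
      near-sym (inj₂ e) = inj₂ (symm′ e)

      forward : ∀ i → Near (inject₁ i) (suc i)
      forward i = near (step cyc i) (proj₁ (proj₂ bi) i)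

      wrap : Near (fromℕ (suc (suc m))) zero
      wrap = near (close cyc) (proj₂ (proj₂ bi))

      neighbours : ∀ i → ∃ λ j → ∃ λ j′ → j ≢ j′ × Near i j × Near i j′
      neighbours zero    = suc zero , fromℕ (suc (suc m)) , (λ ()) , forward zero , near-sym wrap
      neighbours (suc i) with last-or-inject₁ (suc i)
      ... | inj₁ p = inject₁ i , zero , (λ q → two-steps i p q) , near-sym (forward i) ,
                     subst (λ j → Near j zero) (sym p) wrap
        where
        -- The two cycle neighbours of the last vertex differ because a cycle has at least three
        -- vertices.
        two-steps : ∀ i → suc i ≡ fromℕ (suc (suc m)) → inject₁ i ≢ zero
        two-steps zero    () _
        two-steps (suc i) _  ()
      ... | inj₂ (j , p) = inject₁ i , suc j , differ , near-sym (forward i) ,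
                           subst (λ i → Near i (suc j)) (sym p) (forward j)
        where
        differ : inject₁ i ≢ suc j
        differ q = ℕ.<⇒≢ (ℕ.m<n⇒m<1+n (ℕ.n<1+n (toℕ i)))
          (trans (sym (toℕ-inject₁ i)) (trans (cong toℕ q)
            (cong suc (sym (trans (cong toℕ p) (toℕ-inject₁ j))))))

      both : ∀ i → (∃ λ j → c (f i) (f j) ≡ just a) × (∃ λ j → c (f i) (f j) ≡ just b)
      both i with neighbours i
      ... | j , j′ , j≢j′ , inj₁ e , inj₁ e′ = contradiction (distinct cyc (proper e e′)) j≢j′
      ... | j , j′ , j≢j′ , inj₂ e , inj₂ e′ = contradiction (distinct cyc (proper e e′)) j≢j′
      ... | j , j′ , _    , inj₁ e , inj₂ e′ = (j , e) , (j′ , e′)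
      ... | j , j′ , _    , inj₂ e , inj₁ e′ = (j′ , e′) , (j , e)

      -- By properness the walk cannot leave the cycle, and every vertex of the cycle offers both
      -- colours, so it never gets stuck; but `Valid` makes all alternating walks halt.
      endless : ∀ {k p q i p′ q′ t} → (∀ i → ∃ λ j → c (f i) (f j) ≡ just p) →
                (∀ i → ∃ λ j → c (f i) (f j) ≡ just q) → Walk c k p q (f i) p′ q′ t → ¬ Stuck c p′ t
      endless {i = i} on-p on-q [] stuck = stuck _ (proj₂ (on-p i))
      endless {i = i} on-p on-q (e ∷ w) stuck with on-p i
      ... | j , e′ with refl ← proper e e′ = endless on-q on-p w stuck

    no-cycle : ⊥
    no-cycle = let open Halts (halts (proj₁ bi) (f zero)) in
      endless (proj₁ ∘ both) (proj₂ ∘ both) walk stuck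

theorem1 : ∀ (n : ℕ) (G : Graph n) → Regular 4 G → TriangleFree G
    → AcyclicEdgeColourable G 6
theorem1 n G regular triangleFree with Assembly.build G regular triangleFree n ℕ.≤-refl
... | c , valid , total = colouring , is-proper , λ _ cyc _ _ → no-cycle cyc
  where open Conversion G valid (λ e → total (e , toℕ<n _ , toℕ<n _))
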